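{- For every $C\in\mathbb{B}^{\ell\times m}$ and $D\in\mathbb{B}^{\ell\times n}$ there is a Presburger formula $\widetilde{\textsf{BiREG}}_{C,D}(\bar X,\bar Y)$ such that for all $\bar M\in\mathbb{N}^m$, $\bar N\in\mathbb{N}^n$ that are big enough with respect to $C,D$: there exists a $(C,D)$-biregular graph of size $(\bar M,\bar N)$ if and only if $\widetilde{\textsf{BiREG}}_{C,D}(\bar M,\bar N)$ holds.
   Context: A Presburger formula is a first-order formula with $+,\le,0,1$ interpreted over $\mathbb{N}$. $\mathbb{B}=\mathbb{N}\cup\{{\ge}d\mid d\in\mathbb{N}\}$, where "$x={\ge}d$" means $x\ge d$; $\lfloor{\ge}d\rfloor=d$, $\lfloor d\rfloor=d$, applied componentwise. Dot products of $\mathbb{B}$-vectors are computed after applying $\lfloor\cdot\rfloor$; $C\cdot\bar1=\sum_{i,j}\lfloor C_{i,j}\rfloor$; $\chi(\bar t)$ is the 0/1-vector with entry $0$ exactly where $\lfloor t_i\rfloor=0$. With rows $\bar c_i$ of $C$ and $\bar d_i$ of $D$, $\bar M=(M_1,\dots,M_m)$, $\bar N=(N_1,\dots,N_n)$ are big enough with respect to $C,D$ if for every $i\le\ell$: (1) $\bar M\cdot\chi(\bar c_i)+\bar N\cdot\chi(\bar d_i)\ge2(C\cdot\bar1)(D\cdot\bar1)+3$; (2) $\sum_{j:\,D_{i,j}\text{ of the form }{\ge}k}N_j\ge\max_{1\le j\le m}\lfloor C_{i,j}\rfloor$; (3) $\sum_{j:\,C_{i,j}\text{ of the form }{\ge}k}M_j\ge\max_{1\le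 j\le n}\lfloor D_{i,j}\rfloor$. An $\ell$-type bipartite graph is $G=(U,V,E_1,\dots,E_\ell)$ with pairwise disjoint $E_i\subseteq U\times V$; $\deg_{E_i}(u)$ is the number of $E_i$-edges at $u$. $G$ is $(C,D)$-biregular of size $(\bar M,\bar N)$ if there are partitions $U=U_1\cup\dots\cup U_m$, $V=V_1\cup\dots\cup V_n$ with $|U_j|=M_j$, $|V_j|=N_j$, $\deg_{E_i}(u)=C_{i,j}$ for $u\in U_j$ and $\deg_{E_i}(v)=D_{i,j}$ for $v\in V_j$. -}

module Defs where

open import Data.Nat using (ℕ; zero; suc; _+_; _*_; _≤_; _⊔_)
open import Data.Fin using (Fin; splitAt; _≟_)
import Data.Fin as F
open import Data.Bool using (Bool; true; false; _∧_; if_then_else_)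
open import Data.Sum using (_⊎_; inj₁; inj₂; [_,_]′)
open import Data.Product using (Σ; _×_; _,_)
open import Data.Empty using (⊥)
open import Data.Unit using (⊤)
open import Relation.Nullary using (¬_)
open import Relation.Nullary.Decidable using (⌊_⌋)
open import Relation.Binary.PropositionalEquality using (_≡_)

sumFin : ∀ {k} → (Fin k → ℕ) → ℕ
sumFin {zero}  f = 0
sumFin {suc k} f = f F.zero + sumFin (λ i → f (F.suc i))

maxFin : ∀ {k} → (Fin k → ℕ) → ℕ
maxFin {zero}  f = 0
maxFin {suc k} f = f F.zero ⊔ maxFin (λ i → f (F.suc i))

count : ∀ {k} → (Fin k → Bool) → ℕ
count f = sumFin (λ i → if f i then 1 else 0)

data 𝔹 : Set where
  exact   : ℕ → 𝔹
  atLeast : ℕ → 𝔹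

⌊_⌋𝔹 : 𝔹 → ℕ
⌊ exact d ⌋𝔹   = d
⌊ atLeast d ⌋𝔹 = d

isAtLeast : 𝔹 → Bool
isAtLeast (exact _)   = false
isAtLeast (atLeast _) = true

_≐_ : ℕ → 𝔹 → Set
x ≐ exact d   = x ≡ d
x ≐ atLeast d = d ≤ x

χ : 𝔹 → ℕ
χ t with ⌊ t ⌋𝔹
... | zero  = 0
... | suc _ = 1

Mat : ℕ → ℕ → Set
Mat ℓ k = Fin ℓ → Fin k → 𝔹

sumMat : ∀ {ℓ k} → Mat ℓ k → ℕ
sumMat C = sumFin (λ i → sumFin (λ j → ⌊ C i j ⌋𝔹))

BigEnough : ∀ {ℓ m n} → Mat ℓ m → Mat ℓ n → (Fin m → ℕ) → (Fin n → ℕ) → Set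
BigEnough {ℓ} {m} {n} C D M N = (i : Fin ℓ) →
    (2 * sumMat C * sumMat D + 3
       ≤ sumFin (λ j → M j * χ (C i j)) + sumFin (λ j → N j * χ (D i j)))
  × (maxFin (λ j → ⌊ C i j ⌋𝔹)
       ≤ sumFin (λ j → if isAtLeast (D i j) then N j else 0))
  × (maxFin (λ j → ⌊ D i j ⌋𝔹)
       ≤ sumFin (λ j → if isAtLeast (C i j) then M j else 0))

-- ℓ-type bipartite graphs with U = Fin p, V = Fin q;
-- E i u v = true iff (u,v) ∈ E_i.

record BipGraph (ℓ : ℕ) : Set where
  field
    p q      : ℕ
    E        : Fin ℓ → Fin p → Fin q → Bool
    disjoint : ∀ (i i' : Fin ℓ) (u : Fin p) (v : Fin q) →
               ¬ (i ≡ i') → E i u v ∧ E i' u v ≡ false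

open BipGraph public

degU : ∀ {ℓ} (G : BipGraph ℓ) → Fin ℓ → Fin (p G) → ℕ
degU G i u = count (λ v → E G i u v)

degV : ∀ {ℓ} (G : BipGraph ℓ) → Fin ℓ → Fin (q G) → ℕ
degV G i v = count (λ u → E G i u v)

-- G is (C,D)-biregular of size (M,N): partitions given by maps
-- U → Fin m and V → Fin n (block U_j = preimage of j).
IsBiregular : ∀ {ℓ m n} → Mat ℓ m → Mat ℓ n → (Fin m → ℕ) → (Fin n → ℕ)
              → BipGraph ℓ → Set
IsBiregular {ℓ} {m} {n} C D M N G =
  Σ (Fin (p G) → Fin m) λ f →
  Σ (Fin (q G) → Fin n) λ g →
    (∀ j → count (λ u → ⌊ f u ≟ j ⌋) ≡ M j)
  × (∀ j → count (λ v → ⌊ g v ≟ j ⌋) ≡ N j)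
  × (∀ i u → degU G i u ≐ C i (f u))
  × (∀ i v → degV G i v ≐ D i (g v))

BiregExists : ∀ {ℓ m n} → Mat ℓ m → Mat ℓ n → (Fin m → ℕ) → (Fin n → ℕ) → Set
BiregExists {ℓ} C D M N = Σ (BipGraph ℓ) (IsBiregular C D M N)

-- Presburger arithmetic: first-order logic over (ℕ, +, ≤, 0, 1),
-- variables as de Bruijn indices in Fin k.

data Term (k : ℕ) : Set where
  var  : Fin k → Term k
  `0   : Term k
  `1   : Term k
  _`+_ : Term k → Term k → Term k

data Formula (k : ℕ) : Set where
  _`≤_ : Term k → Term k → Formula k
  `¬_  : Formula k → Formula k
  _`∧_ : Formula k → Formula k → Formula k
  _`∨_ : Formula k → Formula k → Formula k
  `∃_  : Formula (suc k) → Formula k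
  `∀_  : Formula (suc k) → Formula k

extend : ∀ {k} → ℕ → (Fin k → ℕ) → Fin (suc k) → ℕ
extend x ρ F.zero    = x
extend x ρ (F.suc i) = ρ i

evalT : ∀ {k} → Term k → (Fin k → ℕ) → ℕ
evalT (var i)   ρ = ρ i
evalT `0        ρ = 0
evalT `1        ρ = 1
evalT (s `+ t)  ρ = evalT s ρ + evalT t ρ

⟦_⟧ : ∀ {k} → Formula k → (Fin k → ℕ) → Set
⟦ s `≤ t ⟧ ρ = evalT s ρ ≤ evalT t ρ
⟦ `¬ φ ⟧   ρ = ¬ ⟦ φ ⟧ ρ
⟦ φ `∧ ψ ⟧ ρ = ⟦ φ ⟧ ρ × ⟦ ψ ⟧ ρ
⟦ φ `∨ ψ ⟧ ρ = ⟦ φ ⟧ ρ ⊎ ⟦ ψ ⟧ ρ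
⟦ `∃ φ ⟧   ρ = Σ ℕ λ x → ⟦ φ ⟧ (extend x ρ)
⟦ `∀ φ ⟧   ρ = (x : ℕ) → ⟦ φ ⟧ (extend x ρ)

-- assignment of (X̄, Ȳ) := (M̄, N̄) to the m + n free variables
_⊕_ : ∀ {m n} → (Fin m → ℕ) → (Fin n → ℕ) → Fin (m + n) → ℕ
_⊕_ {m} M N i = [ M , N ]′ (splitAt m i)

{-# OPTIONS --safe #-}
-- Removing one vertex from a biregular graph leaves a biregular graph whose demands on the other
-- side are lowered according to the colour of the edge to the removed vertex; in terms of the
-- sizes of the parts this is a Presburger relation. Fix a large K. As long as, for some colour and
-- side, the total demand or the number of vertices of the form ≥d is positive but below K, remove
-- a vertex that contributes to it. The sum of these quantities, each truncated at K, drops, so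
-- after boundedly many removals each of them is 0 or at least K. Then counting edges gives linear
-- conditions, which conversely suffice: a core graph with exactly prescribed bounded degrees is
-- built edge by edge, switching along an existing edge of the same colour when an edge is blocked,
-- and demand beyond the core is absorbed by the many vertices of the form ≥d on the other side.
module Submission where

open import Defs
open import Data.Nat using (ℕ; zero; suc; _+_; _*_; _∸_; _⊓_; _≤_; _<_; z≤n; s≤s; _≤?_; _<?_)
open import Data.Nat.Properties hiding (_≟_; suc-injective)
open import Data.Fin using (Fin; zero; suc; _≟_; punchIn; combine; quotient; remainder; splitAt; opposite; _↑ˡ_; _↑ʳ_)
open import Data.Fin.Properties using (any?; suc-injective; combine-injective; combine-remQuot; remQuot-combine; splitAt-↑ˡ; splitAt-↑ʳ)
open import Data.Bool using (Bool; true; false; if_then_else_; _∧_)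
open import Data.Bool.Properties using (∧-comm) renaming (_≟_ to _≟ᵇ_)
open import Data.Sum using (_⊎_; inj₁; inj₂; [_,_]′; map₁)
open import Data.Sum.Function.Propositional using (_⊎-⇔_)
open import Data.Product using (Σ; ∃; uncurry; _×_; _,_; proj₁; proj₂)
open import Data.Product.Function.NonDependent.Propositional using (_×-⇔_)
open import Function using (_∘_; flip)
open import Function.Bundles using (_⇔_; mk⇔; Equivalence)
open import Function.Construct.Composition using (_⇔-∘_)
open import Relation.Nullary using (¬_; Dec; yes; no; contradiction; _×-dec_)
open import Relation.Nullary.Decidable using (⌊_⌋)
open import Relation.Binary.PropositionalEquality
open import Algebra.Properties.CommutativeSemigroup +-commutativeSemigroup using (interchange; x∙yz≈y∙xz)

open Equivalence using (to; from)

-- Finite sums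

-- The obstacle is small numbers. In a colour with few edges every edge may be too close to the
-- blocked pair to be switched, and if only few vertices of the form `atLeast` exist, a vertex with
-- surplus demand may already be joined to all of them. Such small quantities are therefore
-- exhausted by removals. The price of a removal is that neighbours of the removed vertex in
-- different colours must be told apart: every part on the other side splits into `suc ℓ` parts, so
-- the matrix and the number of size variables change. Two facts keep the recursion uniform. Entries
-- never grow, so one `B` and one `K` serve at every depth. Truncated at `K`, the measure is at most
-- `4 * ℓ * K` for graphs of every size, so the depth, and with it the formula, is fixed before the
-- sizes are known. The two absorptions, of surplus on the left and of surplus on the right, could
-- compete for the same pair of vertices. Splitting both vertex sets into two halves in advance
-- decides which of the two may use a pair.

sum-cong : ∀ {k} {f g : Fin k → ℕ} → (∀ x → f x ≡ g x) → sumFin f ≡ sumFin g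
sum-cong {zero}  h = refl
sum-cong {suc k} h = cong₂ _+_ (h zero) (sum-cong (h ∘ suc))

sum-mono : ∀ {k} {f g : Fin k → ℕ} → (∀ x → f x ≤ g x) → sumFin f ≤ sumFin g
sum-mono {zero}  h = z≤n
sum-mono {suc k} h = +-mono-≤ (h zero) (sum-mono (h ∘ suc))

sum-zero : ∀ {k} {f : Fin k → ℕ} → (∀ x → f x ≡ 0) → sumFin f ≡ 0
sum-zero {zero}  h = refl
sum-zero {suc k} h = cong₂ _+_ (h zero) (sum-zero (h ∘ suc))

sum-bound : ∀ {k} {f : Fin k → ℕ} {b} → (∀ x → f x ≤ b) → sumFin f ≤ k * b
sum-bound {zero}  h = z≤n
sum-bound {suc k} h = +-mono-≤ (h zero) (sum-bound (h ∘ suc))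

sum-+ : ∀ {k} (f g : Fin k → ℕ) → sumFin (λ x → f x + g x) ≡ sumFin f + sumFin g
sum-+ {zero}  f g = refl
sum-+ {suc k} f g = trans (cong (f zero + g zero +_) (sum-+ (f ∘ suc) (g ∘ suc)))
                          (interchange (f zero) (g zero) _ _)

sum-*ˡ : ∀ {k} c (f : Fin k → ℕ) → sumFin (λ x → c * f x) ≡ c * sumFin f
sum-*ˡ {zero}  c f = sym (*-zeroʳ c)
sum-*ˡ {suc k} c f = trans (cong (c * f zero +_) (sum-*ˡ c (f ∘ suc)))
                           (sym (*-distribˡ-+ c (f zero) _))

sum-*ʳ : ∀ {k} (f : Fin k → ℕ) c → sumFin (λ x → f x * c) ≡ sumFin f * c
sum-*ʳ f c = trans (sum-cong (λ x → *-comm (f x) c)) (trans (sum-*ˡ c f) (*-comm c _))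

sum-swap : ∀ {k l} (f : Fin k → Fin l → ℕ) →
           sumFin (λ x → sumFin (f x)) ≡ sumFin (λ y → sumFin (λ x → f x y))
sum-swap {zero}  {l} f = sym (sum-zero {l} (λ _ → refl))
sum-swap {suc k} f = trans (cong (sumFin (f zero) +_) (sum-swap (f ∘ suc)))
                           (sym (sum-+ (f zero) _))

term≤sum : ∀ {k} (f : Fin k → ℕ) x → f x ≤ sumFin f
term≤sum f zero    = m≤m+n _ _
term≤sum f (suc x) = ≤-trans (term≤sum (f ∘ suc) x) (m≤n+m _ (f zero))

sum-remove : ∀ {k} (f : Fin (suc k) → ℕ) x → sumFin f ≡ f x + sumFin (f ∘ punchIn x)
sum-remove f zero = refl
sum-remove {suc k} f (suc x) =
  trans (cong (f zero +_) (sum-remove (f ∘ suc) x)) (x∙yz≈y∙xz (f zero) (f (suc x)) _)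

sum-strict : ∀ {k} {f g : Fin k → ℕ} → (∀ x → f x ≤ g x) → ∀ x → f x < g x → sumFin f < sumFin g
sum-strict h zero    lt = +-mono-<-≤ lt (sum-mono (h ∘ suc))
sum-strict h (suc x) lt = +-mono-≤-< (h zero) (sum-strict (h ∘ suc) x lt)

sum-squeeze : ∀ {k} {f g : Fin k → ℕ} → (∀ x → f x ≤ g x) → sumFin g ≤ sumFin f → ∀ x → f x ≡ g x
sum-squeeze h le x = ≤-antisym (h x) (≮⇒≥ (λ lt → <⇒≱ (sum-strict h x lt) le))

sum-deficit : ∀ {k} {f g : Fin k → ℕ} → sumFin f < sumFin g → ∃ λ x → f x < g x
sum-deficit {f = f} {g} lt with any? (λ x → f x <? g x)
... | yes r = r
... | no  r = contradiction (sum-mono (λ x → ≮⇒≥ (λ l → r (x , l)))) (<⇒≱ lt)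

sum-positive : ∀ {k} {f : Fin k → ℕ} → 0 < sumFin f → ∃ λ x → 0 < f x
sum-positive {k} {f} lt =
  sum-deficit {f = λ _ → 0} (subst (_< sumFin f) (sym (sum-zero {k} (λ _ → refl))) lt)

sum≡0⇒≡0 : ∀ {k} {f : Fin k → ℕ} → sumFin f ≡ 0 → ∀ x → f x ≡ 0
sum≡0⇒≡0 {f = f} eq x = n≤0⇒n≡0 (subst (f x ≤_) eq (term≤sum f x))

-- Selects the part of the demand that the core graph serves. Any selection with the right total
-- would do; this one fills from the left.
truncate : ∀ {k} (f : Fin k → ℕ) e → e ≤ sumFin f →
           Σ (Fin k → ℕ) λ g → (∀ x → g x ≤ f x) × sumFin g ≡ e
truncate {zero}  f e le = (λ ()) , (λ ()) , sym (n≤0⇒n≡0 le)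
truncate {suc k} f e le with truncate (f ∘ suc) (e ∸ f zero) (m≤n+o⇒m∸n≤o e (f zero) le)
... | g , g≤f , Σg = h , h≤f , trans (cong (f zero ⊓ e +_) Σg) (m⊓n+n∸m≡n (f zero) e)
  where
  h : Fin (suc k) → ℕ
  h zero    = f zero ⊓ e
  h (suc x) = g x
  h≤f : ∀ x → h x ≤ f x
  h≤f zero    = m⊓n≤m (f zero) e
  h≤f (suc x) = g≤f x

-- Kronecker delta

δ : ∀ {k} → Fin k → Fin k → ℕ
δ x y = if ⌊ x ≟ y ⌋ then 1 else 0

δ-refl : ∀ {k} (x : Fin k) → δ x x ≡ 1
δ-refl x with x ≟ x
... | yes _ = refl
... | no  n = contradiction refl n

δ-≢ : ∀ {k} {x y : Fin k} → x ≢ y → δ x y ≡ 0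
δ-≢ {x = x} {y} n with x ≟ y
... | yes e = contradiction e n
... | no  _ = refl

δ≤1 : ∀ {k} (x y : Fin k) → δ x y ≤ 1
δ≤1 x y with x ≟ y
... | yes _ = ≤-refl
... | no  _ = z≤n

δ-sym : ∀ {k} (x y : Fin k) → δ x y ≡ δ y x
δ-sym x y with x ≟ y
... | yes refl = sym (δ-refl x)
... | no  n    = sym (δ-≢ (n ∘ sym))

δ-suc : ∀ {k} (x y : Fin k) → δ (suc x) (suc y) ≡ δ x y
δ-suc x y with x ≟ y
... | yes _ = refl
... | no  _ = refl

δ-combine : ∀ {m n} (a c : Fin m) (b d : Fin n) → δ (combine a b) (combine c d) ≡ δ a c * δ b d
δ-combine a c b d with a ≟ c | b ≟ d
... | yes refl | yes refl = δ-refl (combine a b)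
... | yes _    | no  n    = δ-≢ (n ∘ proj₂ ∘ combine-injective a b c d)
... | no  n    | _        = δ-≢ (n ∘ proj₁ ∘ combine-injective a b c d)

sum-δˡ : ∀ {k} (f : Fin k → ℕ) y → sumFin (λ x → δ x y * f x) ≡ f y
sum-δˡ {suc k} f zero =
  trans (cong (f zero + 0 +_) (sum-zero {k} (λ _ → refl))) (trans (+-identityʳ _) (+-identityʳ _))
sum-δˡ {suc k} f (suc y) =
  trans (sum-cong (λ x → cong (_* f (suc x)) (δ-suc x y))) (sum-δˡ (f ∘ suc) y)

sum-δʳ : ∀ {k} (f : Fin k → ℕ) y → sumFin (λ x → δ y x * f x) ≡ f y
sum-δʳ f y = trans (sum-cong (λ x → cong (_* f x) (δ-sym y x))) (sum-δˡ f y)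

sum-δ : ∀ {k} (y : Fin k) → sumFin (λ x → δ y x) ≡ 1
sum-δ y = trans (sum-cong (λ x → sym (*-identityʳ (δ y x)))) (sum-δʳ (λ _ → 1) y)

sum-δ*ʳ : ∀ {k} (y : Fin k) c → sumFin (λ x → δ x y * c) ≡ c
sum-δ*ʳ y c = sum-δˡ (λ _ → c) y

-- Turns a sum over vertices into an expression linear in the part sizes, the only form in which a
-- formula can speak of it.
sum-fibres : ∀ {p m} (f : Fin p → Fin m) {M : Fin m → ℕ} →
             (∀ j → sumFin (λ u → δ (f u) j) ≡ M j) → (w : Fin m → ℕ) →
             sumFin (λ u → w (f u)) ≡ sumFin (λ j → M j * w j)
sum-fibres f {M} size w = begin
  sumFin (λ u → w (f u))                           ≡⟨ sum-cong (λ u → sum-δʳ w (f u)) ⟨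
  sumFin (λ u → sumFin (λ j → δ (f u) j * w j))    ≡⟨ sum-swap (λ u j → δ (f u) j * w j) ⟩
  sumFin (λ j → sumFin (λ u → δ (f u) j * w j))    ≡⟨ sum-cong (λ j → sum-*ʳ (λ u → δ (f u) j) (w j)) ⟩
  sumFin (λ j → sumFin (λ u → δ (f u) j) * w j)    ≡⟨ sum-cong (λ j → cong (_* w j) (size j)) ⟩
  sumFin (λ j → M j * w j)                         ∎
  where open ≡-Reasoning

sum-splitAt : ∀ a {b} (h : Fin a ⊎ Fin b → ℕ) →
              sumFin (λ x → h (splitAt a x)) ≡ sumFin (h ∘ inj₁) + sumFin (h ∘ inj₂)
sum-splitAt zero    h = refl
sum-splitAt (suc a) h =
  trans (cong (h (inj₁ zero) +_) (trans (sum-cong (λ x → shift (splitAt a x))) (sum-splitAt a h′)))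
        (sym (+-assoc (h (inj₁ zero)) _ _))
  where
  h′ : Fin a ⊎ Fin _ → ℕ
  h′ = [ h ∘ inj₁ ∘ suc , h ∘ inj₂ ]′
  shift : ∀ z → h (map₁ suc z) ≡ h′ z
  shift (inj₁ _) = refl
  shift (inj₂ _) = refl

partition : ∀ {m} (M : Fin m → ℕ) →
            Σ ℕ λ p → Σ (Fin p → Fin m) λ f → ∀ j → sumFin (λ u → δ (f u) j) ≡ M j
partition {zero}  M = 0 , (λ ()) , λ ()
partition {suc m} M with partition (M ∘ suc)
... | p , f , size = M zero + p , (λ x → h (splitAt (M zero) x)) ,
                     λ j → trans (sum-splitAt (M zero) (λ z → δ (h z) j)) (sizes j)
  where
  h : Fin (M zero) ⊎ Fin p → Fin (suc m)
  h = [ (λ _ → zero) , suc ∘ f ]′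
  ones : ∀ k → sumFin {k} (λ _ → 1) ≡ k
  ones zero    = refl
  ones (suc k) = cong suc (ones k)
  sizes : ∀ j → sumFin {M zero} (λ _ → δ zero j) + sumFin (λ u → δ (suc (f u)) j) ≡ M j
  sizes zero    = trans (cong₂ _+_ (ones (M zero)) (sum-zero {p} (λ _ → refl))) (+-identityʳ _)
  sizes (suc j) = cong₂ _+_ (sum-zero {M zero} (λ _ → refl))
                            (trans (sum-cong (λ u → δ-suc (f u) j)) (size j))

-- Greedy systems of representatives

-- The hypothesis is stronger than Hall's condition and maintains itself. An element that can serve
-- an unmet demand is used: the total demand drops by one and each count by at most one. An element
-- that cannot lies in no `R i` with demand left, so discarding it leaves all relevant counts
-- unchanged.
greedy : ∀ {k} q (R : Fin k → Fin q → Bool) (x : Fin k → ℕ) →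
         (∀ i → 0 < x i → sumFin x ≤ count (R i)) →
         Σ (Fin q → Fin (suc k)) λ lab →
           (∀ v i → lab v ≡ suc i → R i v ≡ true) ×
           (∀ i → sumFin (λ v → δ (lab v) (suc i)) ≡ x i)
greedy zero R x room = (λ ()) , (λ ()) , λ i → sym (n≤0⇒n≡0 (≮⇒≥ (λ lt →
  <⇒≱ (<-≤-trans lt (term≤sum x i)) (room i lt))))
greedy {k} (suc q) R x room with any? (λ i → (0 <? x i) ×-dec (R i zero ≟ᵇ true))
... | yes (i₀ , 0<x , r) = lab , lab-R , lab-size
  where
  x′ : Fin k → ℕ
  x′ i = x i ∸ δ i₀ i
  split : ∀ i → δ i₀ i + x′ i ≡ x i
  split i = m+[n∸m]≡n (le i)
    where
    le : ∀ i → δ i₀ i ≤ x i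
    le i with i₀ ≟ i
    ... | yes refl = 0<x
    ... | no  _    = z≤n
  Σx : sumFin x ≡ suc (sumFin x′)
  Σx = trans (sum-cong (sym ∘ split)) (trans (sum-+ _ x′) (cong (_+ sumFin x′) (sum-δ i₀)))
  indicator≤1 : ∀ b → (if b then 1 else 0) ≤ 1
  indicator≤1 true  = ≤-refl
  indicator≤1 false = z≤n
  room′ : ∀ i → 0 < x′ i → sumFin x′ ≤ count (R i ∘ suc)
  room′ i lt = ≤-pred (begin
    suc (sumFin x′)                                    ≡⟨ Σx ⟨
    sumFin x                                           ≤⟨ room i (<-≤-trans lt (m∸n≤m (x i) (δ i₀ i))) ⟩
    (if R i zero then 1 else 0) + count (R i ∘ suc)    ≤⟨ +-monoˡ-≤ _ (indicator≤1 (R i zero)) ⟩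
    suc (count (R i ∘ suc))                            ∎)
    where open ≤-Reasoning
  rec = greedy q (λ i → R i ∘ suc) x′ room′
  lab : Fin (suc q) → Fin (suc k)
  lab zero    = suc i₀
  lab (suc v) = proj₁ rec v
  lab-R : ∀ v i → lab v ≡ suc i → R i v ≡ true
  lab-R zero    i refl = r
  lab-R (suc v) i eq   = proj₁ (proj₂ rec) v i eq
  lab-size : ∀ i → sumFin (λ v → δ (lab v) (suc i)) ≡ x i
  lab-size i = trans (cong₂ _+_ (δ-suc i₀ i) (proj₂ (proj₂ rec) i)) (split i)
... | no none = lab , lab-R , proj₂ (proj₂ rec)
  where
  room′ : ∀ i → 0 < x i → sumFin x ≤ count (R i ∘ suc)
  room′ i lt with R i zero in eq | room i lt
  ... | true  | _  = contradiction (i , lt , eq) none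
  ... | false | le = le
  rec = greedy q (λ i → R i ∘ suc) x room′
  lab : Fin (suc q) → Fin (suc k)
  lab zero    = zero
  lab (suc v) = proj₁ rec v
  lab-R : ∀ v i → lab v ≡ suc i → R i v ≡ true
  lab-R (suc v) i eq = proj₁ (proj₂ rec) v i eq

-- Edge colourings; colour zero means that there is no edge.

Col : ℕ → ℕ → ℕ → Set
Col ℓ p q = Fin p → Fin q → Fin (suc ℓ)

deg : ∀ {ℓ p q} → Col ℓ p q → Fin ℓ → Fin p → ℕ
deg col i u = sumFin (λ v → δ (col u v) (suc i))

handshake : ∀ {ℓ p q} (col : Col ℓ p q) i → sumFin (deg col i) ≡ sumFin (deg (flip col) i)
handshake col i = sum-swap (λ u v → δ (col u v) (suc i))

busy : ∀ {k} → Fin (suc k) → ℕ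
busy zero    = 0
busy (suc _) = 1

busy≤deg : ∀ {ℓ p q} (col : Col ℓ p q) u →
           sumFin (λ v → busy (col u v)) ≤ sumFin (λ i → deg col i u)
busy≤deg col u = begin
  sumFin (λ v → busy (col u v))                           ≤⟨ sum-mono (λ v → busy≤ (col u v)) ⟩
  sumFin (λ v → sumFin (λ i → δ (col u v) (suc i)))       ≡⟨ sum-swap (λ v i → δ (col u v) (suc i)) ⟩
  sumFin (λ i → deg col i u)                              ∎
  where
  open ≤-Reasoning
  busy≤ : ∀ {k} (o : Fin (suc k)) → busy o ≤ sumFin (λ i → δ o (suc i))
  busy≤ zero    = z≤n
  busy≤ (suc j) = subst (_≤ sumFin (λ i → δ (suc j) (suc i))) (δ-refl (suc j)) (term≤sum _ j)

upd : ∀ {ℓ p q} → Col ℓ p q → Fin p → Fin q → Fin (suc ℓ) → Col ℓ p q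
upd col u v w x y = if ⌊ x ≟ u ⌋ ∧ ⌊ y ≟ v ⌋ then w else col x y

upd-elsewhere : ∀ {ℓ p q} (col : Col ℓ p q) {u v} w {x y} → x ≢ u ⊎ y ≢ v → upd col u v w x y ≡ col x y
upd-elsewhere col {u} {v} w {x} {y} h with x ≟ u | y ≟ v | h
... | no _   | _      | _      = refl
... | yes _  | no _   | _      = refl
... | yes e  | yes _  | inj₁ n = contradiction e n
... | yes _  | yes e  | inj₂ n = contradiction e n

flip-upd : ∀ {ℓ p q} (col : Col ℓ p q) u v w y x → upd (flip col) v u w y x ≡ upd col u v w x y
flip-upd col u v w y x = cong (if_then w else col x y) (∧-comm ⌊ y ≟ v ⌋ ⌊ x ≟ u ⌋)

-- New plus removed equals old plus added; this form avoids truncated subtraction when it is summed.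
upd-δ : ∀ {ℓ p q} (col : Col ℓ p q) u v w o x y →
        δ (upd col u v w x y) o + δ x u * (δ y v * δ (col u v) o) ≡ δ (col x y) o + δ x u * (δ y v * δ w o)
upd-δ col u v w o x y with x ≟ u | y ≟ v
... | no _     | _        = refl
... | yes _    | no _     = refl
... | yes refl | yes refl = begin
  δ w o + (δ (col x y) o + 0 + 0)   ≡⟨ cong (δ w o +_) (trans (+-identityʳ _) (+-identityʳ _)) ⟩
  δ w o + δ (col x y) o             ≡⟨ +-comm (δ w o) _ ⟩
  δ (col x y) o + δ w o             ≡⟨ cong (δ (col x y) o +_) (trans (+-identityʳ _) (+-identityʳ _)) ⟨
  δ (col x y) o + (δ w o + 0 + 0)   ∎
  where open ≡-Reasoning

upd-deg : ∀ {ℓ p q} (col : Col ℓ p q) u v w i x →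
          deg (upd col u v w) i x + δ x u * δ (col u v) (suc i) ≡ deg col i x + δ x u * δ w (suc i)
upd-deg {q = q} col u v w i x =
  trans (sym (point (λ y → δ (upd col u v w x y) (suc i)) (δ (col u v) (suc i))))
        (trans (sum-cong (upd-δ col u v w (suc i) x)) (point (λ y → δ (col x y) (suc i)) (δ w (suc i))))
  where
  point : ∀ (F : Fin q → ℕ) A → sumFin (λ y → F y + δ x u * (δ y v * A)) ≡ sumFin F + δ x u * A
  point F A = trans (sum-+ F _) (cong (sumFin F +_)
    (trans (sum-*ˡ (δ x u) (λ y → δ y v * A)) (cong (δ x u *_) (sum-δ*ʳ v A))))

-- Records an edge operation by its effect on the degrees of one side only, so that operations
-- compose without another look at the colouring. Erasing is a gain read backwards, and the other
-- side is reached through `flip`.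
Gain : ∀ {ℓ p q} → Col ℓ p q → Col ℓ p q → Fin ℓ → Fin p → Set
Gain col col′ i u = ∀ i′ x → deg col′ i′ x ≡ deg col i′ x + δ x u * δ (suc i) (suc i′)

paint-gain : ∀ {ℓ p q} (col : Col ℓ p q) u v i → col u v ≡ zero → Gain col (upd col u v (suc i)) i u
paint-gain col u v i free i′ x with upd-deg col u v (suc i) i′ x
... | eq rewrite free | *-zeroʳ (δ x u) | +-identityʳ (deg (upd col u v (suc i)) i′ x) = eq

erase-gain : ∀ {ℓ p q} (col : Col ℓ p q) u v i → col u v ≡ suc i → Gain (upd col u v zero) col i u
erase-gain col u v i used i′ x with upd-deg col u v zero i′ x
... | eq rewrite used | *-zeroʳ (δ x u) | +-identityʳ (deg col i′ x) = sym eq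

deg-flip-upd : ∀ {ℓ p q} (col : Col ℓ p q) u v w i′ y →
                deg (upd (flip col) v u w) i′ y ≡ deg (flip (upd col u v w)) i′ y
deg-flip-upd col u v w i′ y = sum-cong (λ x → cong (λ o → δ o (suc i′)) (flip-upd col u v w y x))

paint-gainᵀ : ∀ {ℓ p q} (col : Col ℓ p q) u v i → col u v ≡ zero →
              Gain (flip col) (flip (upd col u v (suc i))) i v
paint-gainᵀ col u v i free i′ y =
  trans (sym (deg-flip-upd col u v (suc i) i′ y)) (paint-gain (flip col) v u i free i′ y)

erase-gainᵀ : ∀ {ℓ p q} (col : Col ℓ p q) u v i → col u v ≡ suc i →
              Gain (flip (upd col u v zero)) (flip col) i v
erase-gainᵀ col u v i used i′ y =
  trans (erase-gain (flip col) v u i used i′ y) (cong (_+ _) (deg-flip-upd col u v zero i′ y))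

-- The edge (u′,v′) is rerouted as (u,v′) and (u′,v).
switch : ∀ {ℓ p q} (col : Col ℓ p q) {u v u′ v′ i} →
         col u′ v′ ≡ suc i → col u v′ ≡ zero → col u′ v ≡ zero →
         Σ (Col ℓ p q) λ col′ → Gain col col′ i u × Gain (flip col) (flip col′) i v
switch col {u} {v} {u′} {v′} {i} used free₁ free₂ =
  col₃ ,
  swapped {c₀ = col} {col₁} {col₂} {col₃}
    (erase-gain col u′ v′ i used) (paint-gain col₁ u v′ i f₁) (paint-gain col₂ u′ v i f₂) ,
  swapped′ {c₀ = flip col} {flip col₁} {flip col₂} {flip col₃}
    (erase-gainᵀ col u′ v′ i used) (paint-gainᵀ col₁ u v′ i f₁) (paint-gainᵀ col₂ u′ v i f₂)
  where
  col₁ = upd col u′ v′ zero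
  col₂ = upd col₁ u v′ (suc i)
  col₃ = upd col₂ u′ v (suc i)
  clash : ∀ {k} {o : Fin (suc k)} {i} → o ≡ suc i → o ≢ zero
  clash refl ()
  u≢u′ : u ≢ u′
  u≢u′ refl = clash used free₁
  v≢v′ : v ≢ v′
  v≢v′ refl = clash used free₂
  f₁ : col₁ u v′ ≡ zero
  f₁ = trans (upd-elsewhere col zero (inj₁ u≢u′)) free₁
  f₂ : col₂ u′ v ≡ zero
  f₂ = trans (upd-elsewhere col₁ (suc i) (inj₁ (u≢u′ ∘ sym)))
             (trans (upd-elsewhere col zero (inj₂ v≢v′)) free₂)
  -- Among the rows, the loss at `u′` is made good by the third update; among the columns, treated
  -- by `swapped′`, the loss at `v′` is made good already by the second.
  swapped : ∀ {p q} {c₀ c₁ c₂ c₃ : Col _ p q} {x y} → Gain c₁ c₀ i y → Gain c₁ c₂ i x → Gain c₂ c₃ i y →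
            Gain c₀ c₃ i x
  swapped {c₀ = c₀} {c₁} {c₂} {c₃} {x} {y} g₁ g₂ g₃ i′ z = begin
    deg c₃ i′ z              ≡⟨ g₃ i′ z ⟩
    deg c₂ i′ z + Y          ≡⟨ cong (_+ Y) (g₂ i′ z) ⟩
    deg c₁ i′ z + X + Y      ≡⟨ +-assoc (deg c₁ i′ z) X Y ⟩
    deg c₁ i′ z + (X + Y)    ≡⟨ cong (deg c₁ i′ z +_) (+-comm X Y) ⟩
    deg c₁ i′ z + (Y + X)    ≡⟨ +-assoc (deg c₁ i′ z) Y X ⟨
    deg c₁ i′ z + Y + X      ≡⟨ cong (_+ X) (g₁ i′ z) ⟨
    deg c₀ i′ z + X          ∎
    where
    open ≡-Reasoning
    X = δ z x * δ (suc i) (suc i′)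
    Y = δ z y * δ (suc i) (suc i′)
  swapped′ : ∀ {p q} {c₀ c₁ c₂ c₃ : Col _ p q} {x y} → Gain c₁ c₀ i y → Gain c₁ c₂ i y → Gain c₂ c₃ i x →
             Gain c₀ c₃ i x
  swapped′ {x = x} g₁ g₂ g₃ i′ z =
    trans (g₃ i′ z) (cong (_+ δ z x * δ (suc i) (suc i′)) (trans (g₂ i′ z) (sym (g₁ i′ z))))

-- Graphs with exactly prescribed bounded degrees

sum-weighted : ∀ {k} (f g : Fin k → ℕ) {s b} → sumFin f ≤ s → (∀ x → g x ≤ b) →
               sumFin (λ x → f x * g x) ≤ s * b
sum-weighted f g {s} {b} Σf≤s g≤b = begin
  sumFin (λ x → f x * g x)  ≤⟨ sum-mono (λ x → *-monoʳ-≤ (f x) (g≤b x)) ⟩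
  sumFin (λ x → f x * b)    ≡⟨ sum-*ʳ f b ⟩
  sumFin f * b              ≤⟨ *-monoˡ-≤ b Σf≤s ⟩
  s * b                     ∎
  where open ≤-Reasoning

-- Origin of the constant in `large`: with `Δ = ℓ * B` bounding the degree over all colours, a
-- vertex for which neither a direct edge nor a switch is available forces at most `Δ * B + Δ * B`
-- edges of the colour and at most `Δ * B` unmet demand on the other side. A colour without demand
-- needs no edges, hence the guard.
module _ {ℓ p q} (B : ℕ) (a : Fin ℓ → Fin p → ℕ) (b : Fin ℓ → Fin q → ℕ)
         (a≤B : ∀ i u → a i u ≤ B) (b≤B : ∀ i v → b i v ≤ B)
         (Σa≡Σb : ∀ i → sumFin (a i) ≡ sumFin (b i))
         (large : ∀ i → 0 < sumFin (a i) → (ℓ * B * B + ℓ * B * B) + ℓ * B * B < sumFin (a i)) where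

  private
    Δ = ℓ * B

  Within : Col ℓ p q → Set
  Within col = (∀ i u → deg col i u ≤ a i u) × (∀ i v → deg (flip col) i v ≤ b i v)

  module _ (col : Col ℓ p q) (within : Within col) where

    private
      ≤a = proj₁ within
      ≤b = proj₂ within

      busy-row : ∀ u → sumFin (λ v → busy (col u v)) ≤ Δ
      busy-row u = ≤-trans (busy≤deg col u) (sum-bound (λ i → ≤-trans (≤a i u) (a≤B i u)))

      busy-column : ∀ v → sumFin (λ u → busy (col u v)) ≤ Δ
      busy-column v = ≤-trans (busy≤deg (flip col) v) (sum-bound (λ i → ≤-trans (≤b i v) (b≤B i v)))

    -- Few edges of colour i meet a neighbour of u or a neighbour of v.
    no-switch⇒few : ∀ i u v → ¬ (∃ λ u′ → ∃ λ v′ → col u′ v′ ≡ suc i × col u v′ ≡ zero × col u′ v ≡ zero) →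
                    sumFin (deg col i) ≤ Δ * B + Δ * B
    no-switch⇒few i u v none = begin
      sumFin (λ x → sumFin (λ y → e x y))
        ≤⟨ sum-mono (λ x → sum-mono (λ y → cover (col x y) (col u y) (col x v) (λ h → none (x , y , h)))) ⟩
      sumFin (λ x → sumFin (λ y → busy (col u y) * e x y + busy (col x v) * e x y))
        ≡⟨ sum-cong (λ x → sum-+ (λ y → busy (col u y) * e x y) (λ y → busy (col x v) * e x y)) ⟩
      sumFin (λ x → sumFin (λ y → busy (col u y) * e x y) + sumFin (λ y → busy (col x v) * e x y))
        ≡⟨ sum-+ (λ x → sumFin (λ y → busy (col u y) * e x y)) _ ⟩
      sumFin (λ x → sumFin (λ y → busy (col u y) * e x y)) + sumFin (λ x → sumFin (λ y → busy (col x v) * e x y))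
        ≡⟨ cong₂ _+_ (trans (sum-swap (λ x y → busy (col u y) * e x y))
                            (sum-cong (λ y → sum-*ˡ (busy (col u y)) (λ x → e x y))))
                     (sum-cong (λ x → sum-*ˡ (busy (col x v)) (e x))) ⟩
      sumFin (λ y → busy (col u y) * deg (flip col) i y) + sumFin (λ x → busy (col x v) * deg col i x)
        ≤⟨ +-mono-≤ (sum-weighted (λ y → busy (col u y)) (deg (flip col) i) (busy-row u)
                                  (λ y → ≤-trans (≤b i y) (b≤B i y)))
                    (sum-weighted (λ x → busy (col x v)) (deg col i) (busy-column v)
                                  (λ x → ≤-trans (≤a i x) (a≤B i x))) ⟩
      Δ * B + Δ * B ∎
      where
      open ≤-Reasoning
      e : Fin p → Fin q → ℕ
      e x y = δ (col x y) (suc i)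
      cover : ∀ o o₁ o₂ → ¬ (o ≡ suc i × o₁ ≡ zero × o₂ ≡ zero) →
              δ o (suc i) ≤ busy o₁ * δ o (suc i) + busy o₂ * δ o (suc i)
      cover o (suc _) o₂      n = ≤-trans (m≤m+n _ 0) (m≤m+n _ _)
      cover o zero    (suc _) n = m≤m+n _ 0
      cover o zero    zero    n = ≤-reflexive (δ-≢ (λ eq → n (eq , refl , refl)))

    -- Every vertex with unmet demand is then one of the at most `Δ` neighbours of `u`, and each of
    -- these lacks at most `B`.
    no-free⇒few : ∀ i u → ¬ (∃ λ v → deg (flip col) i v < b i v × col u v ≡ zero) →
                  sumFin (b i) ≤ sumFin (deg col i) + Δ * B
    no-free⇒few i u none = begin
      sumFin (b i)
        ≤⟨ sum-mono (λ v → cover v (col u v) (λ h → none (v , h))) ⟩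
      sumFin (λ v → deg (flip col) i v + busy (col u v) * B)
        ≡⟨ sum-+ (deg (flip col) i) (λ v → busy (col u v) * B) ⟩
      sumFin (deg (flip col) i) + sumFin (λ v → busy (col u v) * B)
        ≤⟨ +-mono-≤ (≤-reflexive (sym (handshake col i)))
                    (sum-weighted (λ v → busy (col u v)) (λ _ → B) (busy-row u) (λ _ → ≤-refl)) ⟩
      sumFin (deg col i) + Δ * B ∎
      where
      open ≤-Reasoning
      cover : ∀ v (o : Fin (suc ℓ)) → ¬ (deg (flip col) i v < b i v × o ≡ zero) →
              b i v ≤ deg (flip col) i v + busy o * B
      cover v zero    n = ≤-trans (≮⇒≥ (λ lt → n (lt , refl))) (m≤m+n _ _)
      cover v (suc _) n = ≤-trans (b≤B i v) (≤-trans (m≤m+n B 0) (m≤n+m _ (deg (flip col) i v)))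

    -- If no vertex with unmet demand is free for `u`, one that is possibly adjacent to `u` still
    -- exists, because the demands on both sides have the same total. A switch then raises the
    -- degrees of `u` and `v` without using the pair `(u,v)`. If no switch exists either, the two
    -- counting bounds together contradict `large`.
    augment : ∀ i u → deg col i u < a i u →
              Σ (Col ℓ p q) λ col′ → ∃ λ v →
                deg (flip col) i v < b i v × Gain col col′ i u × Gain (flip col) (flip col′) i v
    augment i u lt with any? (λ v → (deg (flip col) i v <? b i v) ×-dec (col u v ≟ zero))
    ... | yes (v , short , free) =
          upd col u v (suc i) , v , short , paint-gain col u v i free , paint-gainᵀ col u v i free
    ... | no no-free
        with sum-deficit {f = deg (flip col) i} {b i}
               (subst₂ _<_ (handshake col i) (Σa≡Σb i) (sum-strict (≤a i) u lt))
    ... | v , short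
        with any? (λ u′ → any? (λ v′ → (col u′ v′ ≟ suc i) ×-dec ((col u v′ ≟ zero) ×-dec (col u′ v ≟ zero))))
    ... | yes (u′ , v′ , used , free₁ , free₂) = let col′ , g , gᵀ = switch col used free₁ free₂ in
          col′ , v , short , g , gᵀ
    ... | no no-switch = contradiction
          (begin-strict
            Δ * B + Δ * B + Δ * B       <⟨ large i (<-≤-trans (≤-<-trans z≤n lt) (term≤sum (a i) u)) ⟩
            sumFin (a i)                ≡⟨ Σa≡Σb i ⟩
            sumFin (b i)                ≤⟨ no-free⇒few i u no-free ⟩
            sumFin (deg col i) + Δ * B  ≤⟨ +-monoˡ-≤ (Δ * B) (no-switch⇒few i u v no-switch) ⟩
            Δ * B + Δ * B + Δ * B       ∎)
          (<-irrefl refl)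
          where open ≤-Reasoning

  private
    total : (Fin ℓ → Fin p → ℕ) → ℕ
    total f = sumFin (λ i → sumFin (f i))

    gain-total : ∀ {col col′ : Col ℓ p q} {i u} → Gain col col′ i u → total (deg col′) ≡ suc (total (deg col))
    gain-total {col} {col′} {i} {u} g = begin
      total (deg col′)
        ≡⟨ sum-cong (λ i′ → sum-cong (g i′)) ⟩
      sumFin (λ i′ → sumFin (λ x → deg col i′ x + δ x u * δ (suc i) (suc i′)))
        ≡⟨ sum-cong (λ i′ → sum-+ (deg col i′) _) ⟩
      sumFin (λ i′ → sumFin (deg col i′) + sumFin (λ x → δ x u * δ (suc i) (suc i′)))
        ≡⟨ sum-cong (λ i′ → cong (sumFin (deg col i′) +_) (trans (sum-δ*ʳ u _) (δ-suc i i′))) ⟩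
      sumFin (λ i′ → sumFin (deg col i′) + δ i i′)
        ≡⟨ sum-+ (λ i′ → sumFin (deg col i′)) (δ i) ⟩
      total (deg col) + sumFin (δ i)
        ≡⟨ cong (total (deg col) +_) (sum-δ i) ⟩
      total (deg col) + 1
        ≡⟨ +-comm _ 1 ⟩
      suc (total (deg col)) ∎
      where open ≡-Reasoning

    gain-within : ∀ {p q} {col col′ : Col ℓ p q} {i u} (c : Fin ℓ → Fin p → ℕ) →
                  (∀ i u → deg col i u ≤ c i u) → deg col i u < c i u → Gain col col′ i u →
                  ∀ i u → deg col′ i u ≤ c i u
    gain-within {col = col} {i = i} {u} c ≤c lt g i′ x = ≤-trans (≤-reflexive (g i′ x)) (bound i′ x)
      where
      bound : ∀ i′ x → deg col i′ x + δ x u * δ (suc i) (suc i′) ≤ c i′ x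
      bound i′ x with x ≟ u | i ≟ i′
      ... | yes refl | yes refl rewrite +-comm (deg col i x) 1 = lt
      ... | yes refl | no _ rewrite +-identityʳ (deg col i′ x) = ≤c i′ x
      ... | no _     | _    rewrite +-identityʳ (deg col i′ x) = ≤c i′ x

    Saturated : Col ℓ p q → Set
    Saturated col = (∀ i u → deg col i u ≡ a i u) × (∀ i v → deg (flip col) i v ≡ b i v)

    saturated : ∀ col → Within col → (∀ i u → deg col i u ≡ a i u) → Saturated col
    saturated col (_ , ≤b) ≡a = ≡a , λ i → sum-squeeze (≤b i) (≤-reflexive
      (trans (sym (Σa≡Σb i)) (trans (sum-cong (sym ∘ ≡a i)) (handshake col i))))

    saturate : ∀ r col → Within col → total a ≤ r + total (deg col) → Σ (Col ℓ p q) Saturated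
    saturate zero col within@(≤a , _) le = col , saturated col within λ i → sum-squeeze (≤a i)
      (≤-reflexive (sym (sum-squeeze (λ i → sum-mono (≤a i)) le i)))
    saturate (suc r) col within@(≤a , ≤b) le with any? (λ i → any? (λ u → deg col i u <? a i u))
    ... | no none = col , saturated col within
          λ i u → ≤-antisym (≤a i u) (≮⇒≥ (λ lt → none (i , u , lt)))
    ... | yes (i , u , lt) with augment col within i u lt
    ... | col′ , v , short , g , gᵀ = saturate r col′
          (gain-within {col = col} {col′} a ≤a lt g , gain-within {col = flip col} {flip col′} b ≤b short gᵀ)
          (≤-trans le (≤-reflexive (trans (sym (+-suc r _)) (cong (r +_) (sym (gain-total {col} {col′} g))))))

  core : Σ (Col ℓ p q) λ col → (∀ i u → deg col i u ≡ a i u) × (∀ i v → deg (flip col) i v ≡ b i v)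
  core = saturate (total a) (λ _ _ → zero) (empty {q = q} a , empty {q = p} b) (m≤m+n _ _)
    where
    empty : ∀ {p q} (c : Fin ℓ → Fin p → ℕ) i (u : Fin p) → sumFin {q} (λ _ → 0) ≤ c i u
    empty {q = q} c i u = ≤-trans (≤-reflexive (sum-zero {q} (λ _ → refl))) z≤n

-- Absorbing surplus demand

δ≤indicator : ∀ {k} {x y : Fin k} (b : Bool) → (x ≡ y → b ≡ true) → δ x y ≤ (if b then 1 else 0)
δ≤indicator {x = x} {y} b h with x ≟ y
... | no _  = z≤n
... | yes e rewrite h e = ≤-refl

≟-complete : ∀ {k} {x y : Fin k} → x ≡ y → ⌊ x ≟ y ⌋ ≡ true
≟-complete {x = x} {y} e with x ≟ y
... | yes _ = refl
... | no  n = contradiction e n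

≟-sound : ∀ {k} (x y : Fin k) → ⌊ x ≟ y ⌋ ≡ true → x ≡ y
≟-sound x y h with x ≟ y
... | yes e = e

∧-true : ∀ {b c} → b ∧ c ≡ true → b ≡ true × c ≡ true
∧-true {true} {true} refl = refl , refl

-- Each set with at least `K` members reserves `r` of them for either side. That makes at most
-- `2 * ℓ` requests of size `r`, and `K` covers their total, so `greedy` serves them disjointly.
-- Smaller sets request nothing.
balanced-split : ∀ {ℓ q} (Q : Fin ℓ → Fin q → Bool) r K → 2 * ℓ * r ≤ K →
                 Σ (Fin q → Fin 2) λ s → ∀ i → K ≤ count (Q i) →
                   ∀ side → r ≤ count (λ v → Q i v ∧ ⌊ s v ≟ side ⌋)
balanced-split {ℓ} {q} Q r K le = s , λ i large side → begin
  r                                                            ≡⟨ need-large i side large ⟨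
  need (combine side i)                                        ≡⟨ lab-size (combine side i) ⟨
  sumFin (λ v → δ (lab v) (suc (combine side i)))              ≤⟨ sum-mono (λ v → δ≤indicator (Q i v ∧ ⌊ s v ≟ side ⌋) (hit v side i)) ⟩
  count (λ v → Q i v ∧ ⌊ s v ≟ side ⌋)                         ∎
  where
  open ≤-Reasoning
  class : Fin (2 * ℓ) → Fin ℓ
  class = remainder {2} ℓ
  amount : Fin ℓ → ℕ
  amount i = if ⌊ K ≤? count (Q i) ⌋ then r else 0
  amount≤r : ∀ i → amount i ≤ r
  amount≤r i with K ≤? count (Q i)
  ... | yes _ = ≤-refl
  ... | no  _ = z≤n
  amount-positive : ∀ i → 0 < amount i → K ≤ count (Q i)
  amount-positive i lt with K ≤? count (Q i)
  ... | yes K≤ = K≤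
  amount-large : ∀ i → K ≤ count (Q i) → amount i ≡ r
  amount-large i large with K ≤? count (Q i)
  ... | yes _ = refl
  ... | no  n = contradiction large n
  need : Fin (2 * ℓ) → ℕ
  need z = amount (class z)
  room : ∀ z → 0 < need z → sumFin need ≤ count (Q (class z))
  room z lt = ≤-trans (sum-bound (λ z → amount≤r (class z))) (≤-trans le (amount-positive (class z) lt))
  need-large : ∀ i side → K ≤ count (Q i) → need (combine side i) ≡ r
  need-large i side large =
    trans (cong amount (cong proj₂ (remQuot-combine {2} {ℓ} side i))) (amount-large i large)
  greed = greedy q (Q ∘ class) need room
  lab = proj₁ greed
  lab-size = proj₂ (proj₂ greed)
  side-of : Fin (suc (2 * ℓ)) → Fin 2
  -- Vertices that nobody reserved may go to either side.
  side-of zero    = zero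
  side-of (suc z) = quotient ℓ z
  s : Fin q → Fin 2
  s v = side-of (lab v)
  hit : ∀ v side i → lab v ≡ suc (combine side i) → (Q i v ∧ ⌊ s v ≟ side ⌋) ≡ true
  hit v side i eq = cong₂ _∧_
    (subst (λ j → Q j v ≡ true) (cong proj₂ (remQuot-combine {2} {ℓ} side i)) (proj₁ (proj₂ greed) v _ eq))
    (≟-complete (trans (cong side-of eq) (cong proj₁ (remQuot-combine {2} {ℓ} side i))))

-- The rows choose independently, since an accepting vertex takes any number of extra edges. Of the
-- `Δ + Δ` candidates on the side of a row at most `Δ` are occupied by `col`, and the remaining ones
-- cover its surplus in all colours together.
fill : ∀ {ℓ p q} Δ (col : Col ℓ p q) (Q : Fin ℓ → Fin q → Bool) (s : Fin q → Fin 2) (t : Fin p → Fin 2)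
       (x : Fin ℓ → Fin p → ℕ) →
       (∀ u → sumFin (λ v → busy (col u v)) ≤ Δ) →
       (∀ u → sumFin (λ i → x i u) ≤ Δ) →
       (∀ i u → 0 < x i u → ∀ side → Δ + Δ ≤ count (λ v → Q i v ∧ ⌊ s v ≟ side ⌋)) →
       Σ (Col ℓ p q) λ lab →
         (∀ u v i → lab u v ≡ suc i → Q i v ≡ true × s v ≡ t u × col u v ≡ zero) ×
         (∀ i u → deg lab i u ≡ x i u)
fill {ℓ} {p} {q} Δ col Q s t x busy≤Δ x≤Δ wide =
  (λ u → proj₁ (row u)) , sound , λ i u → proj₂ (proj₂ (row u)) i
  where
  R : Fin p → Fin ℓ → Fin q → Bool
  R u i v = (Q i v ∧ ⌊ s v ≟ t u ⌋) ∧ ⌊ col u v ≟ zero ⌋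
  free-or-busy : ∀ b (o : Fin (suc ℓ)) →
                 (if b then 1 else 0) ≤ (if b ∧ ⌊ o ≟ zero ⌋ then 1 else 0) + busy o
  free-or-busy false o       = z≤n
  free-or-busy true  zero    = ≤-refl
  free-or-busy true  (suc _) = ≤-refl
  room : ∀ u i → 0 < x i u → sumFin (λ i → x i u) ≤ count (R u i)
  room u i lt = ≤-trans (x≤Δ u) (+-cancelʳ-≤ Δ Δ _ (begin
    Δ + Δ                                              ≤⟨ wide i u lt (t u) ⟩
    count (λ v → Q i v ∧ ⌊ s v ≟ t u ⌋)                ≤⟨ sum-mono (λ v → free-or-busy (Q i v ∧ ⌊ s v ≟ t u ⌋) (col u v)) ⟩
    sumFin (λ v → (if R u i v then 1 else 0) + busy (col u v))
                                                       ≡⟨ sum-+ (λ v → if R u i v then 1 else 0) (λ v → busy (col u v)) ⟩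
    count (R u i) + sumFin (λ v → busy (col u v))      ≤⟨ +-monoʳ-≤ (count (R u i)) (busy≤Δ u) ⟩
    count (R u i) + Δ                                  ∎))
    where open ≤-Reasoning
  row : ∀ u → _
  row u = greedy q (R u) (λ i → x i u) (room u)
  sound : ∀ u v i → proj₁ (row u) v ≡ suc i → Q i v ≡ true × s v ≡ t u × col u v ≡ zero
  sound u v i eq with ∧-true (proj₁ (proj₂ (row u)) v i eq)
  ... | qs , free with ∧-true {Q i v} qs
  ... | q∈Q , same = q∈Q , ≟-sound (s v) (t u) same , ≟-sound (col u v) zero free

orElse : ∀ {k} → Fin (suc k) → Fin (suc k) → Fin (suc k)
orElse zero    y = y
orElse (suc x) y = suc x

orElse-δ : ∀ {k} (x y : Fin (suc k)) i → (∀ j → y ≡ suc j → x ≡ zero) →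
           δ (orElse x y) (suc i) ≡ δ x (suc i) + δ y (suc i)
orElse-δ zero    y       i h = refl
orElse-δ (suc x) zero    i h = sym (+-identityʳ _)
orElse-δ (suc x) (suc y) i h with h y refl
... | ()

floors atLeasts : ∀ {p} → (Fin p → 𝔹) → ℕ
floors   c = sumFin (λ u → ⌊ c u ⌋𝔹)
atLeasts c = count (λ u → isAtLeast (c u))

-- x, y are the total demands of a colour on the two sides and P, Q the numbers of vertices that
-- accept any excess of it. The e edges of a core graph serve both sides at once; whatever demand
-- exceeds e is absorbed by the accepting vertices of the other side.
Balanced : (K e x y P Q : ℕ) → Set
Balanced K e x y P Q = (e ≡ 0 ⊎ K ≤ e) × e ≤ x × e ≤ y × (x ≤ e ⊎ K ≤ Q) × (y ≤ e ⊎ K ≤ P)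

-- The first summand makes every nonempty colour of the core large enough for augmentation, with
-- `suc` for the strict inequality. The second lets `balanced-split` leave `Δ + Δ` accepting
-- vertices on either side for each colour, where `Δ = ℓ * B`.
threshold : ℕ → ℕ → ℕ
threshold ℓ B = suc (ℓ * B * B + ℓ * B * B + ℓ * B * B) + 2 * ℓ * (ℓ * B + ℓ * B)

≐-intro : ∀ b {k z} → k ≡ ⌊ b ⌋𝔹 + z → (isAtLeast b ≡ false → z ≡ 0) → k ≐ b
≐-intro (exact d)   refl h = trans (cong (d +_) (h refl)) (+-identityʳ d)
≐-intro (atLeast d) refl h = m≤m+n d _

opposite≢ : ∀ (x : Fin 2) → x ≢ opposite x
opposite≢ zero       ()
opposite≢ (suc zero) ()

-- Three layers are superposed: the core, the surplus edges chosen by rows and those chosen by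
-- columns. A vertex reaches its floor exactly through the core and its own choices; edges chosen by
-- the other end are excess, which falls only on entries of the form `atLeast`.
module _ {ℓ p q} (c : Fin ℓ → Fin p → 𝔹) (d : Fin ℓ → Fin q → 𝔹)
         (a x : Fin ℓ → Fin p → ℕ) (b y : Fin ℓ → Fin q → ℕ)
         (a+x : ∀ i u → a i u + x i u ≡ ⌊ c i u ⌋𝔹) (b+y : ∀ i v → b i v + y i v ≡ ⌊ d i v ⌋𝔹)
         (s : Fin q → Fin 2) (t : Fin p → Fin 2) (col₀ rl : Col ℓ p q) (cl : Col ℓ q p)
         (col₀-a : ∀ i u → deg col₀ i u ≡ a i u) (col₀-b : ∀ i v → deg (flip col₀) i v ≡ b i v)
         (rl-x : ∀ i u → deg rl i u ≡ x i u) (cl-y : ∀ i v → deg cl i v ≡ y i v)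
         (rl-sound : ∀ u v i → rl u v ≡ suc i → isAtLeast (d i v) ≡ true × s v ≡ t u × col₀ u v ≡ zero)
         (cl-sound : ∀ v u i → cl v u ≡ suc i → isAtLeast (c i u) ≡ true × t u ≡ opposite (s v) × col₀ u v ≡ zero)
         where

  private
    col : Col ℓ p q
    col u v = orElse (col₀ u v) (orElse (rl u v) (cl v u))

    rl-free : ∀ u v j → cl v u ≡ suc j → rl u v ≡ zero
    rl-free u v j eq with rl u v in eq′
    ... | zero  = refl
    ... | suc i = contradiction
      (trans (proj₁ (proj₂ (rl-sound u v i eq′))) (proj₁ (proj₂ (cl-sound v u j eq)))) (opposite≢ (s v))

    col₀-free : ∀ u v j → orElse (rl u v) (cl v u) ≡ suc j → col₀ u v ≡ zero
    col₀-free u v j eq with rl u v in eq′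
    ... | zero  = proj₂ (proj₂ (cl-sound v u j eq))
    ... | suc i = proj₂ (proj₂ (rl-sound u v i eq′))

    col-δ : ∀ i u v → δ (col u v) (suc i) ≡ δ (col₀ u v) (suc i) + (δ (rl u v) (suc i) + δ (cl v u) (suc i))
    col-δ i u v = trans (orElse-δ (col₀ u v) _ i (col₀-free u v))
                        (cong (δ (col₀ u v) (suc i) +_) (orElse-δ (rl u v) (cl v u) i (rl-free u v)))

    row-degree : ∀ i u → deg col i u ≐ c i u
    row-degree i u = ≐-intro (c i u) total none
      where
      open ≡-Reasoning
      z = sumFin (λ v → δ (cl v u) (suc i))
      total : deg col i u ≡ ⌊ c i u ⌋𝔹 + z
      total = begin
        deg col i u                        ≡⟨ sum-cong (col-δ i u) ⟩
        sumFin (λ v → δ (col₀ u v) (suc i) + (δ (rl u v) (suc i) + δ (cl v u) (suc i)))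
          ≡⟨ trans (sum-+ (λ v → δ (col₀ u v) (suc i)) _)
                   (cong (deg col₀ i u +_) (sum-+ (λ v → δ (rl u v) (suc i)) _)) ⟩
        deg col₀ i u + (deg rl i u + z)    ≡⟨ cong₂ (λ m n → m + (n + z)) (col₀-a i u) (rl-x i u) ⟩
        a i u + (x i u + z)                ≡⟨ +-assoc (a i u) (x i u) z ⟨
        a i u + x i u + z                  ≡⟨ cong (_+ z) (a+x i u) ⟩
        ⌊ c i u ⌋𝔹 + z                     ∎
      none : isAtLeast (c i u) ≡ false → z ≡ 0
      none ex = sum-zero (λ v → δ-≢ (λ eq → contradiction (trans (sym (proj₁ (cl-sound v u i eq))) ex) (λ ())))

    column-degree : ∀ i v → deg (flip col) i v ≐ d i v
    column-degree i v = ≐-intro (d i v) total none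
      where
      open ≡-Reasoning
      z = sumFin (λ u → δ (rl u v) (suc i))
      total : deg (flip col) i v ≡ ⌊ d i v ⌋𝔹 + z
      total = begin
        deg (flip col) i v                        ≡⟨ sum-cong (λ u → col-δ i u v) ⟩
        sumFin (λ u → δ (col₀ u v) (suc i) + (δ (rl u v) (suc i) + δ (cl v u) (suc i)))
          ≡⟨ trans (sum-+ (λ u → δ (col₀ u v) (suc i)) _)
                   (cong (deg (flip col₀) i v +_) (sum-+ (λ u → δ (rl u v) (suc i)) _)) ⟩
        deg (flip col₀) i v + (z + deg cl i v)
          ≡⟨ cong₂ (λ m n → m + (z + n)) (col₀-b i v) (cl-y i v) ⟩
        b i v + (z + y i v)                ≡⟨ cong (b i v +_) (+-comm z (y i v)) ⟩
        b i v + (y i v + z)                ≡⟨ +-assoc (b i v) (y i v) z ⟨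
        b i v + y i v + z                  ≡⟨ cong (_+ z) (b+y i v) ⟩
        ⌊ d i v ⌋𝔹 + z                     ∎
      none : isAtLeast (d i v) ≡ false → z ≡ 0
      none ex = sum-zero (λ u → δ-≢ (λ eq → contradiction (trans (sym (proj₁ (rl-sound u v i eq))) ex) (λ ())))

  overlay : Σ (Col ℓ p q) λ col → (∀ i u → deg col i u ≐ c i u) × (∀ i v → deg (flip col) i v ≐ d i v)
  overlay = col , row-degree , column-degree

-- If the core served the whole demand, `a` and `c` would agree everywhere, so surplus at one vertex
-- already leaves only the other alternative.
surplus-absorbed : ∀ {p K e Q} (c a : Fin p → ℕ) → (∀ u → a u ≤ c u) → sumFin a ≡ e →
                   sumFin c ≤ e ⊎ K ≤ Q → ∀ u → 0 < c u ∸ a u → K ≤ Q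
surplus-absorbed c a a≤c refl (inj₂ K≤Q) u lt = K≤Q
surplus-absorbed c a a≤c refl (inj₁ c≤e) u lt =
  contradiction (m≤n⇒m∸n≡0 (≤-reflexive (sym (sum-squeeze a≤c c≤e u)))) (>⇒≢ lt)

balanced⇒colouring : ∀ {ℓ p q} B K (c : Fin ℓ → Fin p → 𝔹) (d : Fin ℓ → Fin q → 𝔹) →
  (∀ i u → ⌊ c i u ⌋𝔹 ≤ B) → (∀ i v → ⌊ d i v ⌋𝔹 ≤ B) → threshold ℓ B ≤ K →
  (∀ i → ∃ λ e → Balanced K e (floors (c i)) (floors (d i)) (atLeasts (c i)) (atLeasts (d i))) →
  Σ (Col ℓ p q) λ col → (∀ i u → deg col i u ≐ c i u) × (∀ i v → deg (flip col) i v ≐ d i v)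
balanced⇒colouring {ℓ} {p} {q} B K c d c≤B d≤B K-large balance =
  overlay c d a x b y (λ i u → m+[n∸m]≡n (a≤c i u)) (λ i v → m+[n∸m]≡n (b≤d i v)) s t col₀
          (proj₁ row-fill) (proj₁ column-fill) col₀-a col₀-b (proj₂ (proj₂ row-fill)) (proj₂ (proj₂ column-fill))
          (proj₁ (proj₂ row-fill)) (proj₁ (proj₂ column-fill))
  where
  Δ = ℓ * B
  P : Fin ℓ → Fin p → Bool
  P i u = isAtLeast (c i u)
  Q : Fin ℓ → Fin q → Bool
  Q i v = isAtLeast (d i v)
  e : Fin ℓ → ℕ
  e i = proj₁ (balance i)

  a-data : ∀ i → _
  a-data i = truncate (λ u → ⌊ c i u ⌋𝔹) (e i) (proj₁ (proj₂ (proj₂ (balance i))))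
  b-data : ∀ i → _
  b-data i = truncate (λ v → ⌊ d i v ⌋𝔹) (e i) (proj₁ (proj₂ (proj₂ (proj₂ (balance i)))))
  a : Fin ℓ → Fin p → ℕ
  a i = proj₁ (a-data i)
  b : Fin ℓ → Fin q → ℕ
  b i = proj₁ (b-data i)
  a≤c : ∀ i u → a i u ≤ ⌊ c i u ⌋𝔹
  a≤c i = proj₁ (proj₂ (a-data i))
  b≤d : ∀ i v → b i v ≤ ⌊ d i v ⌋𝔹
  b≤d i = proj₁ (proj₂ (b-data i))
  Σa : ∀ i → sumFin (a i) ≡ e i
  Σa i = proj₂ (proj₂ (a-data i))
  Σb : ∀ i → sumFin (b i) ≡ e i
  Σb i = proj₂ (proj₂ (b-data i))

  large : ∀ i → 0 < sumFin (a i) → (Δ * B + Δ * B) + Δ * B < sumFin (a i)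
  large i lt with proj₁ (proj₂ (balance i))
  ... | inj₁ e≡0 = contradiction (trans (Σa i) e≡0) (>⇒≢ lt)
  ... | inj₂ K≤e = ≤-trans (≤-trans (m≤m+n _ _) K-large) (≤-trans K≤e (≤-reflexive (sym (Σa i))))

  core-graph = core B a b (λ i u → ≤-trans (a≤c i u) (c≤B i u)) (λ i v → ≤-trans (b≤d i v) (d≤B i v))
                    (λ i → trans (Σa i) (sym (Σb i))) large
  col₀ : Col ℓ p q
  col₀ = proj₁ core-graph
  col₀-a : ∀ i u → deg col₀ i u ≡ a i u
  col₀-a = proj₁ (proj₂ core-graph)
  col₀-b : ∀ i v → deg (flip col₀) i v ≡ b i v
  col₀-b = proj₂ (proj₂ core-graph)

  wide : 2 * ℓ * (Δ + Δ) ≤ K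
  wide = ≤-trans (m≤n+m _ (suc (ℓ * B * B + ℓ * B * B + ℓ * B * B))) K-large
  s-data = balanced-split Q (Δ + Δ) K wide
  t-data = balanced-split P (Δ + Δ) K wide
  s = proj₁ s-data
  t = proj₁ t-data

  x : Fin ℓ → Fin p → ℕ
  x i u = ⌊ c i u ⌋𝔹 ∸ a i u
  y : Fin ℓ → Fin q → ℕ
  y i v = ⌊ d i v ⌋𝔹 ∸ b i v

  row-fill = fill Δ col₀ Q s t x
    (λ u → ≤-trans (busy≤deg col₀ u)
             (sum-bound (λ i → ≤-trans (≤-reflexive (col₀-a i u)) (≤-trans (a≤c i u) (c≤B i u)))))
    (λ u → sum-bound (λ i → ≤-trans (m∸n≤m ⌊ c i u ⌋𝔹 (a i u)) (c≤B i u)))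
    (λ i u lt → proj₂ s-data i (surplus-absorbed (λ u → ⌊ c i u ⌋𝔹) (a i) (a≤c i) (Σa i)
                  (proj₁ (proj₂ (proj₂ (proj₂ (proj₂ (balance i)))))) u lt))
  -- A row only uses columns of its own side and a column only rows of the other side, so the two
  -- absorptions never claim the same pair.
  column-fill = fill Δ (flip col₀) P t (opposite ∘ s) y
    (λ v → ≤-trans (busy≤deg (flip col₀) v)
             (sum-bound (λ i → ≤-trans (≤-reflexive (col₀-b i v)) (≤-trans (b≤d i v) (d≤B i v)))))
    (λ v → sum-bound (λ i → ≤-trans (m∸n≤m ⌊ d i v ⌋𝔹 (b i v)) (d≤B i v)))
    (λ i v lt → proj₂ t-data i (surplus-absorbed (λ v → ⌊ d i v ⌋𝔹) (b i) (b≤d i) (Σb i)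
                  (proj₂ (proj₂ (proj₂ (proj₂ (proj₂ (balance i)))))) v lt))

-- Removing a vertex

-- A colouring builds in the disjointness of the edge sets and makes both sides interchangeable
-- through `flip`, so each argument about removal is needed for one side only.
record Realisation {ℓ m n} (C : Mat ℓ m) (D : Mat ℓ n) (M : Fin m → ℕ) (N : Fin n → ℕ) : Set where
  constructor realisation
  field
    {p} {q}  : ℕ
    f        : Fin p → Fin m
    g        : Fin q → Fin n
    col      : Col ℓ p q
    sizeU    : ∀ j → sumFin (λ u → δ (f u) j) ≡ M j
    sizeV    : ∀ k → sumFin (λ v → δ (g v) k) ≡ N k
    degreeU  : ∀ i u → deg col i u ≐ C i (f u)
    degreeV  : ∀ i v → deg (flip col) i v ≐ D i (g v)

transpose : ∀ {ℓ m n} {C : Mat ℓ m} {D : Mat ℓ n} {M N} → Realisation C D M N → Realisation D C N M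
transpose (realisation f g col sizeU sizeV degreeU degreeV) =
  realisation g f (flip col) sizeV sizeU degreeV degreeU

realisation⇒graph : ∀ {ℓ m n} {C : Mat ℓ m} {D : Mat ℓ n} {M N} → Realisation C D M N → BiregExists C D M N
realisation⇒graph {ℓ} (realisation {p} {q} f g col sizeU sizeV degreeU degreeV) =
  record { p = p ; q = q ; E = λ i u v → ⌊ col u v ≟ suc i ⌋ ; disjoint = λ i i′ u v → apart (col u v) i i′ } ,
  f , g , sizeU , sizeV , degreeU , degreeV
  where
  apart : ∀ (o : Fin (suc ℓ)) i i′ → ¬ (i ≡ i′) → ⌊ o ≟ suc i ⌋ ∧ ⌊ o ≟ suc i′ ⌋ ≡ false
  apart o i i′ i≢i′ with o ≟ suc i | o ≟ suc i′
  ... | no _     | _     = refl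
  ... | yes _    | no _  = refl
  ... | yes refl | yes e = contradiction (suc-injective e) i≢i′

colour : ∀ {ℓ} → (Fin ℓ → Bool) → Fin (suc ℓ)
colour b with any? (λ i → b i ≟ᵇ true)
... | yes (i , _) = suc i
... | no  _       = zero

colour-δ : ∀ {ℓ} (b : Fin ℓ → Bool) → (∀ i i′ → ¬ (i ≡ i′) → b i ∧ b i′ ≡ false) →
           ∀ i → δ (colour b) (suc i) ≡ (if b i then 1 else 0)
colour-δ b apart i with any? (λ i → b i ≟ᵇ true)
... | no none with b i in eq
...   | true  = contradiction (i , eq) none
...   | false = refl
colour-δ b apart i | yes (j , bj) with j ≟ i
...   | yes refl rewrite bj = refl
...   | no j≢i with b i in eq
...     | false = refl
...     | true  = contradiction (trans (sym (cong₂ _∧_ bj eq)) (apart j i j≢i)) (λ ())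

graph⇒realisation : ∀ {ℓ m n} {C : Mat ℓ m} {D : Mat ℓ n} {M N} → BiregExists C D M N → Realisation C D M N
graph⇒realisation {C = C} {D} (G , f , g , sizeU , sizeV , degreeU , degreeV) =
  realisation f g col sizeU sizeV
    (λ i u → subst (_≐ C i (f u)) (sym (sum-cong (λ v → col-E i u v))) (degreeU i u))
    (λ i v → subst (_≐ D i (g v)) (sym (sum-cong (λ u → col-E i u v))) (degreeV i v))
  where
  col : Col _ (BipGraph.p G) (BipGraph.q G)
  col u v = colour (λ i → E G i u v)
  col-E : ∀ i u v → δ (col u v) (suc i) ≡ (if E G i u v then 1 else 0)
  col-E i u v = colour-δ (λ i → E G i u v) (λ i i′ → disjoint G i i′ u v) i

lower : ℕ → 𝔹 → 𝔹
lower e (exact d)   = exact (d ∸ e)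
lower e (atLeast d) = atLeast (d ∸ e)

≐-lower : ∀ e b {k} → (e + k) ≐ b → k ≐ lower e b
≐-lower e (exact d)   refl = sym (m+n∸m≡n e _)
≐-lower e (atLeast d) le   = m≤n+o⇒m∸n≤o d e le

-- Truncated subtraction lowers `exact 0` to itself, so an edge in a forbidden colour would go
-- unnoticed; the second hypothesis rules it out. For all other exact entries `e ≤ 1` makes the
-- subtraction faithful.
≐-raise : ∀ e b {k} → e ≤ 1 → (b ≡ exact 0 → e ≡ 0) → k ≐ lower e b → (e + k) ≐ b
≐-raise e (exact zero)    e≤1 h refl rewrite h refl = refl
≐-raise e (exact (suc d)) e≤1 h refl = m+[n∸m]≡n (≤-trans e≤1 (s≤s z≤n))
≐-raise e (atLeast d)     e≤1 h le   = ≤-trans (m≤n+m∸n d e) (+-monoʳ-≤ e le)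

-- A vertex of kind k joined to the removed vertex by colour o gets the kind (k, o).
refine : ∀ {ℓ n} → Mat ℓ n → Mat ℓ (n * suc ℓ)
refine {ℓ} {n} D i z = lower (δ (remainder {n} (suc ℓ) z) (suc i)) (D i (quotient (suc ℓ) z))

refine-combine : ∀ {ℓ n} (D : Mat ℓ n) i k o → refine D i (combine k o) ≡ lower (δ o (suc i)) (D i k)
refine-combine {ℓ} {n} D i k o =
  cong (λ r → lower (δ (proj₂ r) (suc i)) (D i (proj₁ r))) (remQuot-combine {n} {suc ℓ} k o)

-- Mentions the removed vertex only through sizes: `j` is its part, and `N′` counts the other side
-- by part and by colour of the edge to it. The fourth condition is the extra hypothesis of
-- `≐-raise`. The relation `R` is left open, to be a property of actual graphs or the relation that
-- becomes a formula.
Step : ∀ {ℓ m n} (C : Mat ℓ m) (D : Mat ℓ n) →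
       ((Fin m → ℕ) → (Fin (n * suc ℓ) → ℕ) → Set) → (Fin m → ℕ) → (Fin n → ℕ) → Set
Step {ℓ} {m} {n} C D R M N =
  Σ (Fin m) λ j → Σ (Fin m → ℕ) λ M′ → Σ (Fin (n * suc ℓ) → ℕ) λ N′ →
    (∀ k → M k ≡ δ j k + M′ k) ×
    (∀ k → N k ≡ sumFin (λ o → N′ (combine k o))) ×
    (∀ i → sumFin (λ (k : Fin n) → N′ (combine k (suc i))) ≐ C i j) ×
    (∀ i k → D i k ≡ exact 0 → N′ (combine k (suc i)) ≡ 0) ×
    R M′ N′

add-vertex : ∀ {ℓ m n} {C : Mat ℓ m} {D : Mat ℓ n} {M N} → Step C D (Realisation C (refine D)) M N →
             Realisation C D M N
add-vertex {ℓ} {m} {n} {C} {D} {M} {N}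
  (j , M′ , N′ , M-size , N-size , own , no-excess , realisation {p} {q} f′ g′ col′ sizeU sizeV degreeU degreeV) =
  realisation f kind col (λ k → trans (cong (δ j k +_) (sizeU k)) (sym (M-size k))) sizeV′ degreeU′ degreeV′
  where
  open ≡-Reasoning
  f : Fin (suc p) → Fin m
  f zero    = j
  f (suc u) = f′ u
  kind : Fin q → Fin n
  kind v = quotient (suc ℓ) (g′ v)
  edge : Fin q → Fin (suc ℓ)
  edge v = remainder {n} (suc ℓ) (g′ v)
  col : Col ℓ (suc p) q
  col zero    v = edge v
  col (suc u) v = col′ u v
  g′-δ : ∀ v k o → δ (g′ v) (combine k o) ≡ δ (kind v) k * δ (edge v) o
  g′-δ v k o = trans (cong (λ z → δ z (combine k o)) (sym (combine-remQuot {n} (suc ℓ) (g′ v))))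
                     (δ-combine (kind v) k (edge v) o)
  sizeV′ : ∀ k → sumFin (λ v → δ (kind v) k) ≡ N k
  sizeV′ k = begin
    sumFin (λ v → δ (kind v) k)
      ≡⟨ sum-cong (λ v → trans (sum-*ˡ (δ (kind v) k) (δ (edge v)))
                               (trans (cong (δ (kind v) k *_) (sum-δ (edge v))) (*-identityʳ _))) ⟨
    sumFin (λ v → sumFin (λ o → δ (kind v) k * δ (edge v) o))
      ≡⟨ sum-cong (λ v → sum-cong (λ o → g′-δ v k o)) ⟨
    sumFin (λ v → sumFin (λ o → δ (g′ v) (combine k o)))
      ≡⟨ sum-swap (λ v o → δ (g′ v) (combine k o)) ⟩
    sumFin (λ o → sumFin (λ v → δ (g′ v) (combine k o)))
      ≡⟨ sum-cong (λ o → sizeV (combine k o)) ⟩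
    sumFin (λ o → N′ (combine k o))
      ≡⟨ N-size k ⟨
    N k ∎
  own-degree : ∀ i → deg col i zero ≡ sumFin (λ (k : Fin n) → N′ (combine k (suc i)))
  own-degree i = begin
    sumFin (λ v → δ (edge v) (suc i))
      ≡⟨ sum-cong (λ v → sum-δʳ (λ _ → δ (edge v) (suc i)) (kind v)) ⟨
    sumFin (λ v → sumFin (λ k → δ (kind v) k * δ (edge v) (suc i)))
      ≡⟨ sum-cong (λ v → sum-cong (λ (k : Fin n) → g′-δ v k (suc i))) ⟨
    sumFin (λ v → sumFin (λ (k : Fin n) → δ (g′ v) (combine k (suc i))))
      ≡⟨ sum-swap (λ v (k : Fin n) → δ (g′ v) (combine k (suc i))) ⟩
    sumFin (λ (k : Fin n) → sumFin (λ v → δ (g′ v) (combine k (suc i))))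
      ≡⟨ sum-cong (λ (k : Fin n) → sizeV (combine k (suc i))) ⟩
    sumFin (λ (k : Fin n) → N′ (combine k (suc i))) ∎
  degreeU′ : ∀ i u → deg col i u ≐ C i (f u)
  degreeU′ i zero    = subst (_≐ C i j) (sym (own-degree i)) (own i)
  degreeU′ i (suc u) = degreeU i u
  -- The vertex `v` is itself counted by the class of `kind v` and `edge v`; if that edge had colour
  -- `i`, the class required to be empty would contain `v`.
  unused : ∀ i v → D i (kind v) ≡ exact 0 → δ (edge v) (suc i) ≡ 0
  unused i v eq = begin
    δ (edge v) (suc i)                              ≡⟨ +-identityʳ _ ⟨
    1 * δ (edge v) (suc i)                          ≡⟨ cong (_* δ (edge v) (suc i)) (δ-refl (kind v)) ⟨
    δ (kind v) (kind v) * δ (edge v) (suc i)        ≡⟨ g′-δ v (kind v) (suc i) ⟨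
    δ (g′ v) (combine (kind v) (suc i))
      ≡⟨ sum≡0⇒≡0 {f = λ w → δ (g′ w) (combine (kind v) (suc i))} (trans (sizeV _) (no-excess i (kind v) eq)) v ⟩
    0 ∎
  degreeV′ : ∀ i v → deg (flip col) i v ≐ D i (kind v)
  degreeV′ i v = ≐-raise (δ (edge v) (suc i)) (D i (kind v)) (δ≤1 (edge v) (suc i)) (unused i v) (degreeV i v)

-- Demand, accepting vertices and the potential

weight : Fin 2 → 𝔹 → ℕ
weight zero    b = ⌊ b ⌋𝔹
weight (suc _) b = if isAtLeast b then 1 else 0

-- Lowering preserves the form of an entry and never increases its floor. Hence removing a vertex
-- cannot raise the potential of the other side.
weight-lower : ∀ w e b → weight w (lower e b) ≤ weight w b
weight-lower zero    e (exact d)   = m∸n≤m d e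
weight-lower zero    e (atLeast d) = m∸n≤m d e
weight-lower (suc _) e (exact d)   = ≤-refl
weight-lower (suc _) e (atLeast d) = ≤-refl

load : ∀ {ℓ m p} → Mat ℓ m → (Fin p → Fin m) → Fin ℓ → Fin 2 → ℕ
load C f i w = sumFin (λ u → weight w (C i (f u)))

potential : ∀ {ℓ m p} → ℕ → Mat ℓ m → (Fin p → Fin m) → ℕ
potential K C f = sumFin (λ i → sumFin (λ w → K ⊓ load C f i w))

potential-mono : ∀ {ℓ m m′ p p′} K {C : Mat ℓ m} {C′ : Mat ℓ m′} {f : Fin p → Fin m} {f′ : Fin p′ → Fin m′} →
                 (∀ i w → load C′ f′ i w ≤ load C f i w) → potential K C′ f′ ≤ potential K C f
potential-mono K h = sum-mono (λ i → sum-mono (λ w → ⊓-monoʳ-≤ K (h i w)))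

-- Truncation hides a decrease of a load above `K`, but below `K` it is the identity. This is why
-- only vertices contributing to a small load are removed.
potential-strict : ∀ {ℓ m m′ p p′} K {C : Mat ℓ m} {C′ : Mat ℓ m′} {f : Fin p → Fin m} {f′ : Fin p′ → Fin m′} →
                   (∀ i w → load C′ f′ i w ≤ load C f i w) → ∀ i w → load C f i w < K →
                   load C′ f′ i w < load C f i w → potential K C′ f′ < potential K C f
potential-strict K {C} {C′} {f} {f′} h i w small less =
  sum-strict (λ i → sum-mono (λ w → ⊓-monoʳ-≤ K (h i w))) i
    (sum-strict (λ w → ⊓-monoʳ-≤ K (h i w)) w
      (subst₂ _<_ (sym (m≥n⇒m⊓n≡n (<⇒≤ (<-trans less small)))) (sym (m≥n⇒m⊓n≡n (<⇒≤ small))) less))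

potential-bound : ∀ {ℓ m p} K (C : Mat ℓ m) (f : Fin p → Fin m) → potential K C f ≤ ℓ * (2 * K)
potential-bound K C f = sum-bound (λ i → sum-bound (λ w → m⊓n≤m K (load C f i w)))

potentialᴿ : ∀ {ℓ m n} {C : Mat ℓ m} {D : Mat ℓ n} {M N} → ℕ → Realisation C D M N → ℕ
potentialᴿ {C = C} {D} K r = potential K C (Realisation.f r) + potential K D (Realisation.g r)

Unstable : ∀ {ℓ m p} → ℕ → Mat ℓ m → (Fin p → Fin m) → Set
Unstable K C f = ∃ λ i → ∃ λ w → 0 < load C f i w × load C f i w < K

remove-vertex : ∀ {ℓ m n K} {C : Mat ℓ m} {D : Mat ℓ n} {M N} (r : Realisation C D M N) →
                Unstable K C (Realisation.f r) →
                Step C D (λ M′ N′ → Σ (Realisation C (refine D) M′ N′) λ r′ → potentialᴿ K r′ < potentialᴿ K r) M N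
remove-vertex {ℓ} {m} {n} {K} {C} {D} {M} {N} (realisation {p} {q} f g col sizeU sizeV degreeU degreeV) (i₀ , w₀ , pos , small)
  with sum-positive {f = λ u → weight w₀ (C i₀ (f u))} pos
remove-vertex {ℓ} {m} {n} {K} {C} {D} {M} {N} (realisation {suc p} {q} f g col sizeU sizeV degreeU degreeV) (i₀ , w₀ , pos , small)
  | u₀ , wt>0 =
  f u₀ , M′ , N′ , M-size , N-size , own , no-excess ,
  realisation f′ g′ col′ (λ _ → refl) (λ _ → refl) (λ i u → degreeU i (punchIn u₀ u)) degreeV′ ,
  +-mono-<-≤ (potential-strict K {C} {C} {f} {f′} load-U i₀ w₀ small load-less)
             (potential-mono K {D} {refine D} {g} {g′} load-V)
  where
  open ≡-Reasoning
  f′ : Fin p → Fin m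
  f′ u = f (punchIn u₀ u)
  g′ : Fin q → Fin (n * suc ℓ)
  g′ v = combine (g v) (col u₀ v)
  col′ : Col ℓ p q
  col′ u v = col (punchIn u₀ u) v
  M′ : Fin m → ℕ
  M′ j = sumFin (λ u → δ (f′ u) j)
  N′ : Fin (n * suc ℓ) → ℕ
  N′ z = sumFin (λ v → δ (g′ v) z)
  M-size : ∀ k → M k ≡ δ (f u₀) k + M′ k
  M-size k = trans (sym (sizeU k)) (sum-remove (λ u → δ (f u) k) u₀)
  g′-δ : ∀ k o → N′ (combine k o) ≡ sumFin (λ v → δ (g v) k * δ (col u₀ v) o)
  g′-δ k o = sum-cong (λ v → δ-combine (g v) k (col u₀ v) o)
  N-size : ∀ k → N k ≡ sumFin (λ o → N′ (combine k o))
  N-size k = begin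
    N k
      ≡⟨ sizeV k ⟨
    sumFin (λ v → δ (g v) k)
      ≡⟨ sum-cong (λ v → trans (sum-*ˡ (δ (g v) k) (δ (col u₀ v)))
                               (trans (cong (δ (g v) k *_) (sum-δ (col u₀ v))) (*-identityʳ _))) ⟨
    sumFin (λ v → sumFin (λ o → δ (g v) k * δ (col u₀ v) o))
      ≡⟨ sum-swap (λ v o → δ (g v) k * δ (col u₀ v) o) ⟩
    sumFin (λ o → sumFin (λ v → δ (g v) k * δ (col u₀ v) o))
      ≡⟨ sum-cong (g′-δ k) ⟨
    sumFin (λ o → N′ (combine k o)) ∎
  own : ∀ i → sumFin (λ (k : Fin n) → N′ (combine k (suc i))) ≐ C i (f u₀)
  own i = subst (_≐ C i (f u₀)) (begin
    sumFin (λ v → δ (col u₀ v) (suc i))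
      ≡⟨ sum-cong (λ v → sum-δʳ (λ _ → δ (col u₀ v) (suc i)) (g v)) ⟨
    sumFin (λ v → sumFin (λ k → δ (g v) k * δ (col u₀ v) (suc i)))
      ≡⟨ sum-swap (λ v k → δ (g v) k * δ (col u₀ v) (suc i)) ⟩
    sumFin (λ k → sumFin (λ v → δ (g v) k * δ (col u₀ v) (suc i)))
      ≡⟨ sum-cong (λ k → g′-δ k (suc i)) ⟨
    sumFin (λ (k : Fin n) → N′ (combine k (suc i))) ∎) (degreeU i u₀)
  no-excess : ∀ i k → D i k ≡ exact 0 → N′ (combine k (suc i)) ≡ 0
  no-excess i k eq = trans (g′-δ k (suc i)) (sum-zero none)
    where
    none : ∀ v → δ (g v) k * δ (col u₀ v) (suc i) ≡ 0
    none v with g v ≟ k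
    ... | no _     = refl
    ... | yes refl = trans (+-identityʳ _)
          (sum≡0⇒≡0 {f = λ u → δ (col u v) (suc i)} (subst (deg (flip col) i v ≐_) eq (degreeV i v)) u₀)
  degreeV′ : ∀ i v → deg (flip col′) i v ≐ refine D i (g′ v)
  degreeV′ i v = subst (deg (flip col′) i v ≐_) (sym (refine-combine D i (g v) (col u₀ v)))
    (≐-lower (δ (col u₀ v) (suc i)) (D i (g v))
      (subst (_≐ D i (g v)) (sum-remove (λ u → δ (col u v) (suc i)) u₀) (degreeV i v)))
  load-split : ∀ i w → load C f i w ≡ weight w (C i (f u₀)) + load C f′ i w
  load-split i w = sum-remove (λ u → weight w (C i (f u))) u₀
  load-U : ∀ i w → load C f′ i w ≤ load C f i w
  load-U i w = ≤-trans (m≤n+m _ (weight w (C i (f u₀)))) (≤-reflexive (sym (load-split i w)))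
  load-less : load C f′ i₀ w₀ < load C f i₀ w₀
  load-less = ≤-trans (+-monoˡ-≤ (load C f′ i₀ w₀) wt>0) (≤-reflexive (sym (load-split i₀ w₀)))
  load-V : ∀ i w → load (refine D) g′ i w ≤ load D g i w
  load-V i w = sum-mono (λ v → ≤-trans (≤-reflexive (cong (weight w) (refine-combine D i (g v) (col u₀ v))))
                                       (weight-lower w (δ (col u₀ v) (suc i)) (D i (g v))))

-- Bounded sequences of removals

size : ∀ {ℓ m} → Mat ℓ m → (Fin m → ℕ) → Fin ℓ → Fin 2 → ℕ
size C M i w = sumFin (λ j → M j * weight w (C i j))

BalancedAt : ∀ {ℓ m n} → ℕ → Mat ℓ m → Mat ℓ n → (Fin m → ℕ) → (Fin n → ℕ) → Fin ℓ → ℕ → Set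
BalancedAt K C D M N i e =
  Balanced K e (size C M i zero) (size D N i zero) (size C M i (suc zero)) (size D N i (suc zero))

-- Three core sizes suffice for each colour: nothing, the whole demand on the left, or the whole
-- demand on the right. All three are linear in the sizes, so the choice of core becomes a finite
-- disjunction.
Good : ∀ {ℓ m n} → ℕ → Mat ℓ m → Mat ℓ n → (Fin m → ℕ) → (Fin n → ℕ) → Set
Good K C D M N = ∀ i → BalancedAt K C D M N i 0 ⊎
                       (BalancedAt K C D M N i (size C M i zero) ⊎ BalancedAt K C D M N i (size D N i zero))

-- The recursion is on the number of removals, with the matrices varying along it. A removal on the
-- right is one on the left with the roles exchanged.
Reach : ∀ {ℓ m n} → ℕ → ℕ → Mat ℓ m → Mat ℓ n → (Fin m → ℕ) → (Fin n → ℕ) → Set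
Reach K zero    C D M N = Good K C D M N
Reach K (suc t) C D M N =
  Good K C D M N ⊎ (Step C D (Reach K t C (refine D)) M N ⊎ Step D C (Reach K t D (refine C)) N M)

good⇒realisation : ∀ {ℓ m n} B K (C : Mat ℓ m) (D : Mat ℓ n) {M N} →
  (∀ i j → ⌊ C i j ⌋𝔹 ≤ B) → (∀ i k → ⌊ D i k ⌋𝔹 ≤ B) → threshold ℓ B ≤ K →
  Good K C D M N → Realisation C D M N
good⇒realisation B K C D {M} {N} C≤B D≤B K-large good with partition M | partition N
... | p , f , sizeU | q , g , sizeV =
  realisation f g (proj₁ colouring) sizeU sizeV (proj₁ (proj₂ colouring)) (proj₂ (proj₂ colouring))
  where
  sizeC : ∀ i w → size C M i w ≡ load C f i w
  sizeC i w = sym (sum-fibres f sizeU (λ j → weight w (C i j)))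
  sizeD : ∀ i w → size D N i w ≡ load D g i w
  sizeD i w = sym (sum-fibres g sizeV (λ k → weight w (D i k)))
  balance : ∀ i e → BalancedAt K C D M N i e →
            ∃ λ e → Balanced K e (load C f i zero) (load D g i zero) (load C f i (suc zero)) (load D g i (suc zero))
  balance i e h = e , subst₂ (λ x y → Balanced K e x y _ _) (sizeC i zero) (sizeD i zero)
                        (subst₂ (λ P Q → Balanced K e _ _ P Q) (sizeC i (suc zero)) (sizeD i (suc zero)) h)
  colouring = balanced⇒colouring B K (λ i u → C i (f u)) (λ i v → D i (g v))
    (λ i u → C≤B i (f u)) (λ i v → D≤B i (g v)) K-large
    (λ i → [ balance i _ , [ balance i _ , balance i _ ]′ ]′ (good i))

-- Keeps `B`, and hence the threshold, constant through all removals.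
refine-bound : ∀ {ℓ n B} {D : Mat ℓ n} → (∀ i k → ⌊ D i k ⌋𝔹 ≤ B) → ∀ i z → ⌊ refine D i z ⌋𝔹 ≤ B
refine-bound {ℓ} {n} {D = D} D≤B i z =
  ≤-trans (weight-lower zero (δ (remainder {n} (suc ℓ) z) (suc i)) (D i (quotient (suc ℓ) z))) (D≤B i _)

step-map : ∀ {ℓ m n} {C : Mat ℓ m} {D : Mat ℓ n} {R R′ : (Fin m → ℕ) → (Fin (n * suc ℓ) → ℕ) → Set} {M N} →
           (∀ {M N} → R M N → R′ M N) → Step C D R M N → Step C D R′ M N
step-map h (j , M′ , N′ , M-size , N-size , own , no-excess , r) = j , M′ , N′ , M-size , N-size , own , no-excess , h r

reach⇒realisation : ∀ {ℓ m n} B K t (C : Mat ℓ m) (D : Mat ℓ n) {M N} →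
  (∀ i j → ⌊ C i j ⌋𝔹 ≤ B) → (∀ i k → ⌊ D i k ⌋𝔹 ≤ B) → threshold ℓ B ≤ K →
  Reach K t C D M N → Realisation C D M N
reach⇒realisation B K zero    C D C≤B D≤B K-large good = good⇒realisation B K C D C≤B D≤B K-large good
reach⇒realisation B K (suc t) C D C≤B D≤B K-large (inj₁ good) = good⇒realisation B K C D C≤B D≤B K-large good
reach⇒realisation B K (suc t) C D C≤B D≤B K-large (inj₂ (inj₁ step)) =
  add-vertex (step-map {C = C} {D} (reach⇒realisation B K t C (refine D) C≤B (refine-bound {D = D} D≤B) K-large) step)
reach⇒realisation B K (suc t) C D C≤B D≤B K-large (inj₂ (inj₂ step)) =
  transpose (add-vertex (step-map {C = D} {C} (reach⇒realisation B K t D (refine C) D≤B (refine-bound {D = C} C≤B) K-large) step))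

unstable? : ∀ {ℓ m p} K (C : Mat ℓ m) (f : Fin p → Fin m) →
            Unstable K C f ⊎ (∀ i w → load C f i w ≡ 0 ⊎ K ≤ load C f i w)
unstable? K C f with any? (λ i → any? (λ w → (0 <? load C f i w) ×-dec (load C f i w <? K)))
... | yes u = inj₁ u
... | no  n = inj₂ stable
  where
  stable : ∀ i w → load C f i w ≡ 0 ⊎ K ≤ load C f i w
  stable i w with load C f i w in eq
  ... | zero  = inj₁ refl
  ... | suc l = inj₂ (≮⇒≥ (λ lt → n (i , w , subst (0 <_) (sym eq) (s≤s z≤n) , subst (_< K) (sym eq) lt)))

≐⇒floor≤ : ∀ {k} b → k ≐ b → ⌊ b ⌋𝔹 ≤ k
≐⇒floor≤ (exact d)   refl = ≤-refl
≐⇒floor≤ (atLeast d) le   = le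

exact⇒≡floor : ∀ {k} b → weight (suc zero) b ≡ 0 → k ≐ b → k ≡ ⌊ b ⌋𝔹
exact⇒≡floor (exact d) _ eq = eq

stable⇒balanced : ∀ {ℓ m n} K {C : Mat ℓ m} {D : Mat ℓ n} {M N} (r : Realisation C D M N) →
  let open Realisation r in
  (∀ i w → load C f i w ≡ 0 ⊎ K ≤ load C f i w) → (∀ i w → load D g i w ≡ 0 ⊎ K ≤ load D g i w) →
  ∀ i → let B = λ e → Balanced K e (load C f i zero) (load D g i zero) (load C f i (suc zero)) (load D g i (suc zero)) in
        B 0 ⊎ (B (load C f i zero) ⊎ B (load D g i zero))
stable⇒balanced K {C} {D} (realisation f g col sizeU sizeV degreeU degreeV) stableU stableV i
  with stableU i (suc zero) | stableV i (suc zero)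
... | inj₂ K≤P | inj₂ K≤Q = inj₁ (inj₁ refl , z≤n , z≤n , inj₂ K≤Q , inj₂ K≤P)
... | inj₂ K≤P | inj₁ Q≡0 = inj₂ (inj₁ (stableU i zero , ≤-refl , ≤V , inj₁ ≤-refl , inj₂ K≤P))
  where
  ≤V : load C f i zero ≤ load D g i zero
  ≤V = begin
    load C f i zero            ≤⟨ sum-mono (λ u → ≐⇒floor≤ (C i (f u)) (degreeU i u)) ⟩
    sumFin (deg col i)         ≡⟨ handshake col i ⟩
    sumFin (deg (flip col) i)  ≡⟨ sum-cong (λ v → exact⇒≡floor (D i (g v)) (sum≡0⇒≡0 Q≡0 v) (degreeV i v)) ⟩
    load D g i zero            ∎
    where open ≤-Reasoning
... | inj₁ P≡0 | Q-stable = inj₂ (inj₂ (stableV i zero , ≤U , ≤-refl , absorb Q-stable , inj₁ ≤-refl))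
  where
  ΣU : sumFin (deg (flip col) i) ≡ load C f i zero
  ΣU = trans (sym (handshake col i))
             (sum-cong (λ u → exact⇒≡floor (C i (f u)) (sum≡0⇒≡0 P≡0 u) (degreeU i u)))
  ≤U : load D g i zero ≤ load C f i zero
  ≤U = ≤-trans (sum-mono (λ v → ≐⇒floor≤ (D i (g v)) (degreeV i v))) (≤-reflexive ΣU)
  absorb : load D g i (suc zero) ≡ 0 ⊎ K ≤ load D g i (suc zero) →
           load C f i zero ≤ load D g i zero ⊎ K ≤ load D g i (suc zero)
  absorb (inj₂ K≤Q) = inj₂ K≤Q
  absorb (inj₁ Q≡0) = inj₁ (≤-reflexive (trans (sym ΣU)
    (sum-cong (λ v → exact⇒≡floor (D i (g v)) (sum≡0⇒≡0 Q≡0 v) (degreeV i v)))))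

stable⇒good : ∀ {ℓ m n} K {C : Mat ℓ m} {D : Mat ℓ n} {M N} (r : Realisation C D M N) →
  let open Realisation r in
  (∀ i w → load C f i w ≡ 0 ⊎ K ≤ load C f i w) → (∀ i w → load D g i w ≡ 0 ⊎ K ≤ load D g i w) →
  Good K C D M N
stable⇒good K {C} {D} {M} {N} r stableU stableV i =
  transfer (sizeC zero) (sizeD zero) (sizeC (suc zero)) (sizeD (suc zero)) (stable⇒balanced K r stableU stableV i)
  where
  open Realisation r
  sizeC : ∀ w → load C f i w ≡ size C M i w
  sizeC w = sum-fibres f sizeU (λ j → weight w (C i j))
  sizeD : ∀ w → load D g i w ≡ size D N i w
  sizeD w = sum-fibres g sizeV (λ k → weight w (D i k))
  transfer : ∀ {x x′ y y′ P P′ Q Q′} → x ≡ x′ → y ≡ y′ → P ≡ P′ → Q ≡ Q′ →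
             Balanced K 0 x y P Q ⊎ (Balanced K x x y P Q ⊎ Balanced K y x y P Q) →
             Balanced K 0 x′ y′ P′ Q′ ⊎ (Balanced K x′ x′ y′ P′ Q′ ⊎ Balanced K y′ x′ y′ P′ Q′)
  transfer refl refl refl refl h = h

good⇒reach : ∀ {ℓ m n} K t {C : Mat ℓ m} {D : Mat ℓ n} {M N} → Good K C D M N → Reach K t C D M N
good⇒reach K zero    good = good
good⇒reach K (suc t) good = inj₁ good

realisation⇒reach : ∀ {ℓ m n} K t {C : Mat ℓ m} {D : Mat ℓ n} {M N} (r : Realisation C D M N) →
                    potentialᴿ K r ≤ t → Reach K t C D M N
realisation⇒reach K t {C} {D} r le with unstable? K C (Realisation.f r) | unstable? K D (Realisation.g r)
realisation⇒reach K zero {C} {D} r le | inj₁ u | _ with remove-vertex r u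
... | _ , _ , _ , _ , _ , _ , _ , _ , less with <-≤-trans less le
... | ()
realisation⇒reach K (suc t) {C} {D} r le | inj₁ u | _ =
  inj₂ (inj₁ (step-map {C = C} {D} (λ (r′ , less) → realisation⇒reach K t r′ (≤-pred (≤-trans less le)))
                       (remove-vertex r u)))
realisation⇒reach K t {C} {D} r le | inj₂ _ | inj₁ u with
  remove-vertex (transpose r) u | ≤-trans (≤-reflexive (+-comm (potential K D (Realisation.g r)) _)) le
realisation⇒reach K zero {C} {D} r le | inj₂ _ | inj₁ u | _ , _ , _ , _ , _ , _ , _ , _ , less | le′ with <-≤-trans less le′
... | ()
realisation⇒reach K (suc t) {C} {D} r le | inj₂ _ | inj₁ u | step | le′ =
  inj₂ (inj₂ (step-map {C = D} {C} (λ (r′ , less) → realisation⇒reach K t r′ (≤-pred (≤-trans less le′))) step))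
realisation⇒reach K t r le | inj₂ stableU | inj₂ stableV = good⇒reach K t (stable⇒good K r stableU stableV)

-- Presburger definability

renameT : ∀ {k k′} → (Fin k → Fin k′) → Term k → Term k′
renameT σ (var x)  = var (σ x)
renameT σ `0       = `0
renameT σ `1       = `1
renameT σ (s `+ t) = renameT σ s `+ renameT σ t

lift : ∀ {k k′} → (Fin k → Fin k′) → Fin (suc k) → Fin (suc k′)
lift σ zero    = zero
lift σ (suc x) = suc (σ x)

rename : ∀ {k k′} → (Fin k → Fin k′) → Formula k → Formula k′
rename σ (s `≤ t) = renameT σ s `≤ renameT σ t
rename σ (`¬ φ)   = `¬ rename σ φ
rename σ (φ `∧ ψ) = rename σ φ `∧ rename σ ψ
rename σ (φ `∨ ψ) = rename σ φ `∨ rename σ ψ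
rename σ (`∃ φ)   = `∃ rename (lift σ) φ
rename σ (`∀ φ)   = `∀ rename (lift σ) φ

renameT-eval : ∀ {k k′} (σ : Fin k → Fin k′) t {ρ ρ′} → (∀ x → ρ x ≡ ρ′ (σ x)) →
               evalT t ρ ≡ evalT (renameT σ t) ρ′
renameT-eval σ (var x)  h = h x
renameT-eval σ `0       h = refl
renameT-eval σ `1       h = refl
renameT-eval σ (s `+ t) h = cong₂ _+_ (renameT-eval σ s h) (renameT-eval σ t h)

rename-eval : ∀ {k k′} (σ : Fin k → Fin k′) φ {ρ ρ′} → (∀ x → ρ x ≡ ρ′ (σ x)) →
              ⟦ φ ⟧ ρ ⇔ ⟦ rename σ φ ⟧ ρ′
rename-eval σ (s `≤ t) h = mk⇔ (subst₂ _≤_ (renameT-eval σ s h) (renameT-eval σ t h))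
                               (subst₂ _≤_ (sym (renameT-eval σ s h)) (sym (renameT-eval σ t h)))
rename-eval σ (`¬ φ) h = mk⇔ (_∘ from (rename-eval σ φ h)) (_∘ to (rename-eval σ φ h))
rename-eval σ (φ `∧ ψ) h = rename-eval σ φ h ×-⇔ rename-eval σ ψ h
rename-eval σ (φ `∨ ψ) h = rename-eval σ φ h ⊎-⇔ rename-eval σ ψ h
rename-eval σ (`∃ φ) {ρ} {ρ′} h = mk⇔ (λ (x , e) → x , to (body x) e) (λ (x , e) → x , from (body x) e)
  where
  body : ∀ x → ⟦ φ ⟧ (extend x ρ) ⇔ ⟦ rename (lift σ) φ ⟧ (extend x ρ′)
  body x = rename-eval (lift σ) φ λ { zero → refl ; (suc y) → h y }
rename-eval σ (`∀ φ) {ρ} {ρ′} h = mk⇔ (λ e x → to (body x) (e x)) (λ e x → from (body x) (e x))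
  where
  body : ∀ x → ⟦ φ ⟧ (extend x ρ) ⇔ ⟦ rename (lift σ) φ ⟧ (extend x ρ′)
  body x = rename-eval (lift σ) φ λ { zero → refl ; (suc y) → h y }

⊕-ˡ : ∀ {a k} (τ : Fin a → ℕ) (ρ : Fin k → ℕ) x → (τ ⊕ ρ) (x ↑ˡ k) ≡ τ x
⊕-ˡ {a} {k} τ ρ x = cong [ τ , ρ ]′ (splitAt-↑ˡ a x k)

⊕-ʳ : ∀ {a k} (τ : Fin a → ℕ) (ρ : Fin k → ℕ) x → (τ ⊕ ρ) (a ↑ʳ x) ≡ ρ x
⊕-ʳ {a} {k} τ ρ x = cong [ τ , ρ ]′ (splitAt-↑ʳ a k x)

-- Predicates range over environments of named data, which `ν` flattens to an assignment. Formulas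
-- can thus be assembled together with their correctness, with few de Bruijn indices in sight.
Definable : ∀ {Env : Set} {k} → (Env → Fin k → ℕ) → (Env → Set) → Set
Definable {k = k} ν P = Σ (Formula k) λ φ → ∀ e → P e ⇔ ⟦ φ ⟧ (ν e)

Linear : ∀ {Env : Set} {k} → (Env → Fin k → ℕ) → (Env → ℕ) → Set
Linear {k = k} ν t = Σ (Term k) λ s → ∀ e → evalT s (ν e) ≡ t e

_▸_ : ∀ {Env : Set} {k} a → (Env → Fin k → ℕ) → (Fin a → ℕ) × Env → Fin (a + k) → ℕ
(a ▸ ν) (τ , e) = τ ⊕ ν e

linear-here : ∀ {Env : Set} {k a} {ν : Env → Fin k → ℕ} x → Linear (a ▸ ν) (λ (τ , _) → τ x)
linear-here {k = k} {ν = ν} x = var (x ↑ˡ k) , λ (τ , e) → ⊕-ˡ τ (ν e) x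

linear-there : ∀ {Env : Set} {k a} {ν : Env → Fin k → ℕ} {t} → Linear ν t → Linear (a ▸ ν) (t ∘ proj₂)
linear-there {a = a} {ν} (s , eq) = renameT (a ↑ʳ_) s , λ (τ , e) →
  trans (sym (renameT-eval (a ↑ʳ_) s (λ x → sym (⊕-ʳ τ (ν e) x)))) (eq e)

module _ {Env : Set} {k} {ν : Env → Fin k → ℕ} where

  linear-+ : ∀ {s t} → Linear ν s → Linear ν t → Linear ν (λ e → s e + t e)
  linear-+ (s , s≡) (t , t≡) = s `+ t , λ e → cong₂ _+_ (s≡ e) (t≡ e)

  linear-const : ∀ c → Linear ν (λ _ → c)
  linear-const zero    = `0 , λ _ → refl
  linear-const (suc c) = linear-+ (`1 , λ _ → refl) (linear-const c)

  linear-* : ∀ {t} → Linear ν t → ∀ c → Linear ν (λ e → t e * c)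
  linear-* {t} l zero    = `0 , λ e → sym (*-zeroʳ (t e))
  linear-* {t} l (suc c) with linear-+ l (linear-* l c)
  ... | s , eq = s , λ e → trans (eq e) (sym (*-suc (t e) c))

  linear-sum : ∀ {a} {t : Fin a → Env → ℕ} → (∀ x → Linear ν (t x)) → Linear ν (λ e → sumFin (λ x → t x e))
  linear-sum {zero}  l = `0 , λ _ → refl
  linear-sum {suc a} l = linear-+ (l zero) (linear-sum (l ∘ suc))

  infixr 2 _∧ᵈ_
  infixr 1 _∨ᵈ_

  _≤ᵈ_ : ∀ {s t} → Linear ν s → Linear ν t → Definable ν (λ e → s e ≤ t e)
  (s , s≡) ≤ᵈ (t , t≡) = s `≤ t , λ e →
    mk⇔ (subst₂ _≤_ (sym (s≡ e)) (sym (t≡ e))) (subst₂ _≤_ (s≡ e) (t≡ e))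

  _∧ᵈ_ : ∀ {P Q} → Definable ν P → Definable ν Q → Definable ν (λ e → P e × Q e)
  (φ , p) ∧ᵈ (ψ , q) = φ `∧ ψ , λ e → p e ×-⇔ q e

  _∨ᵈ_ : ∀ {P Q} → Definable ν P → Definable ν Q → Definable ν (λ e → P e ⊎ Q e)
  (φ , p) ∨ᵈ (ψ , q) = φ `∨ ψ , λ e → p e ⊎-⇔ q e

  _≡ᵈ_ : ∀ {s t} → Linear ν s → Linear ν t → Definable ν (λ e → s e ≡ t e)
  s ≡ᵈ t with (s ≤ᵈ t) ∧ᵈ (t ≤ᵈ s)
  ... | φ , h = φ , λ e → h e ⇔-∘ mk⇔ (λ eq → ≤-reflexive eq , ≤-reflexive (sym eq)) (uncurry ≤-antisym)

  _≐ᵈ_ : ∀ {s} → Linear ν s → ∀ b → Definable ν (λ e → s e ≐ b)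
  s ≐ᵈ exact d   = s ≡ᵈ linear-const d
  s ≐ᵈ atLeast d = linear-const d ≤ᵈ s

  -- The premise concerns fixed matrix entries, not the variables, and is decided while the formula
  -- is built.
  whenᵈ : ∀ {A : Set} {P} → Dec A → Definable ν P → Definable ν (λ e → A → P e)
  whenᵈ (yes a) (φ , h) = φ , λ e → h e ⇔-∘ mk⇔ (λ p → p a) (λ p _ → p)
  whenᵈ (no ¬a) _       = `0 `≤ `0 , λ e → mk⇔ (λ _ → z≤n) (λ _ a → contradiction a ¬a)

  allᵈ : ∀ {a} {P : Fin a → Env → Set} → (∀ x → Definable ν (P x)) → Definable ν (λ e → ∀ x → P x e)
  allᵈ {zero}  d = `0 `≤ `0 , λ e → mk⇔ (λ _ → z≤n) (λ _ ())
  allᵈ {suc a} {P} d with d zero ∧ᵈ allᵈ (d ∘ suc)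
  ... | φ , h = φ , λ e → h e ⇔-∘ mk⇔ (λ p → p zero , p ∘ suc) (λ (p , ps) → λ { zero → p ; (suc x) → ps x })

  anyᵈ : ∀ {a} {P : Fin a → Env → Set} → (∀ x → Definable ν (P x)) → Definable ν (λ e → Σ (Fin a) λ x → P x e)
  anyᵈ {zero}  d = `1 `≤ `0 , λ e → mk⇔ (λ ()) (λ ())
  anyᵈ {suc a} {P} d with d zero ∨ᵈ anyᵈ (d ∘ suc)
  ... | φ , h = φ , λ e → h e ⇔-∘
        mk⇔ (λ { (zero , p) → inj₁ p ; (suc x , p) → inj₂ (x , p) }) [ (zero ,_) , (λ (x , p) → suc x , p) ]′

  ∃ᵈ : ∀ {a} {P : (Fin a → ℕ) × Env → Set} → Definable (a ▸ ν) P → Definable ν (λ e → Σ (Fin a → ℕ) λ τ → P (τ , e))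
  ∃ᵈ {zero}      (φ , h) = φ , λ e → mk⇔ (λ (τ , p) → to (h (τ , e)) p) (λ q → (λ ()) , from (h ((λ ()) , e)) q)
  ∃ᵈ {suc a} {P} (φ , h)
    -- The assignment under the new quantifier agrees with `τ ⊕ ν e` only pointwise, not
    -- definitionally. Renaming along the identity lets `rename-eval` carry truth from one to the
    -- other.
    with ∃ᵈ {a} {λ e → ⟦ `∃ rename (λ x → x) φ ⟧ ((a ▸ ν) e)}
            (`∃ rename (λ x → x) φ , λ _ → mk⇔ (λ p → p) (λ p → p))
  ... | ψ , h′ = ψ , λ e → h′ e ⇔-∘ mk⇔
    (λ (τ , p) → τ ∘ suc , τ zero , to (rename-eval (λ x → x) φ (shift τ e)) (to (h (τ , e)) p))
    (λ (τ , x , p) → extend x τ , from (h (extend x τ , e)) (from (rename-eval (λ x → x) φ (shift (extend x τ) e)) p))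
    where
    shift : ∀ τ e x → (τ ⊕ ν e) x ≡ extend (τ zero) ((τ ∘ suc) ⊕ ν e) x
    shift τ e zero    = refl
    shift τ e (suc x) with splitAt a x
    ... | inj₁ _ = refl
    ... | inj₂ _ = refl

  renameᵈ : ∀ {Env′ : Set} {k′} {ν′ : Env′ → Fin k′ → ℕ} {P} (h : Env′ → Env) (σ : Fin k → Fin k′) →
            (∀ e x → ν (h e) x ≡ ν′ e (σ x)) → Definable ν P → Definable ν′ (P ∘ h)
  renameᵈ h σ eq (φ , d) = rename σ φ , λ e → rename-eval σ φ (eq e) ⇔-∘ d (h e)

-- Formulas for balance, removal and reachability

exact-zero? : ∀ b → Dec (b ≡ exact 0)
exact-zero? (exact zero)    = yes refl
exact-zero? (exact (suc _)) = no λ ()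
exact-zero? (atLeast _)     = no λ ()

pair : ∀ {m n} → (Fin m → ℕ) × (Fin n → ℕ) → Fin (m + n) → ℕ
pair (M , N) = M ⊕ N

linear-M : ∀ {m n} (j : Fin m) → Linear (pair {m} {n}) (λ (M , _) → M j)
linear-M {n = n} j = var (j ↑ˡ n) , λ (M , N) → ⊕-ˡ M N j

linear-N : ∀ {m n} (k : Fin n) → Linear (pair {m} {n}) (λ (_ , N) → N k)
linear-N {m} k = var (m ↑ʳ k) , λ (M , N) → ⊕-ʳ M N k

good-definable : ∀ {ℓ m n} K (C : Mat ℓ m) (D : Mat ℓ n) → Definable pair (uncurry (Good K C D))
good-definable {m = m} {n} K C D = allᵈ λ i →
  balanced i (linear-const 0) ∨ᵈ balanced i (sizeC i zero) ∨ᵈ balanced i (sizeD i zero)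
  where
  ν = pair {m} {n}
  sizeC : ∀ i w → Linear ν (λ (M , _) → size C M i w)
  sizeC i w = linear-sum (λ j → linear-* (linear-M j) (weight w (C i j)))
  sizeD : ∀ i w → Linear ν (λ (_ , N) → size D N i w)
  sizeD i w = linear-sum (λ k → linear-* (linear-N k) (weight w (D i k)))
  balanced : ∀ i {t} → Linear ν t → Definable ν (λ e → uncurry (BalancedAt K C D) e i (t e))
  balanced i t =
    ((t ≡ᵈ linear-const 0) ∨ᵈ (linear-const K ≤ᵈ t)) ∧ᵈ
    (t ≤ᵈ sizeC i zero) ∧ᵈ
    (t ≤ᵈ sizeD i zero) ∧ᵈ
    ((sizeC i zero ≤ᵈ t) ∨ᵈ (linear-const K ≤ᵈ sizeD i (suc zero))) ∧ᵈ
    ((sizeD i zero ≤ᵈ t) ∨ᵈ (linear-const K ≤ᵈ sizeC i (suc zero)))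

step-definable : ∀ {ℓ m n} (C : Mat ℓ m) (D : Mat ℓ n) {R} → Definable pair (uncurry R) →
                 Definable pair (uncurry (Step C D R))
step-definable {ℓ} {m} {n} C D {R} R-definable = anyᵈ λ j → ∃ᵈ (∃ᵈ
  ( (allᵈ λ k → M k ≡ᵈ linear-+ (linear-const (δ j k)) (M′ k)) ∧ᵈ
    (allᵈ λ k → N k ≡ᵈ linear-sum (λ o → N′ (combine k o))) ∧ᵈ
    (allᵈ λ i → linear-sum (λ (k : Fin n) → N′ (combine k (suc i))) ≐ᵈ C i j) ∧ᵈ
    (allᵈ λ i → allᵈ λ k → whenᵈ (exact-zero? (D i k)) (N′ (combine k (suc i)) ≡ᵈ linear-const 0)) ∧ᵈ
    renameᵈ (λ (N′ , M′ , _) → M′ , N′) (λ x → σ (splitAt m x)) σ-eq R-definable))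
  where
  n′ = n * suc ℓ
  ν = n′ ▸ (m ▸ pair {m} {n})
  M : ∀ k → Linear ν (λ (_ , _ , M , _) → M k)
  M k = linear-there {a = n′} {ν = m ▸ pair} (linear-there {a = m} {ν = pair} (linear-M k))
  N : ∀ k → Linear ν (λ (_ , _ , _ , N) → N k)
  N k = linear-there {a = n′} {ν = m ▸ pair} (linear-there {a = m} {ν = pair} (linear-N k))
  M′ : ∀ k → Linear ν (λ (_ , M′ , _) → M′ k)
  M′ k = linear-there {a = n′} {ν = m ▸ pair} (linear-here {a = m} {ν = pair} k)
  N′ : ∀ z → Linear ν (λ (N′ , _) → N′ z)
  N′ z = linear-here {a = n′} {ν = m ▸ pair} z
  -- The formula for `R` expects `M′` before `N′` and nothing else, while the block quantified last
  -- stands in front and the old sizes come at the end.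
  σ : Fin m ⊎ Fin n′ → Fin (n′ + (m + (m + n)))
  σ = [ (λ x → n′ ↑ʳ (x ↑ˡ (m + n))) , (_↑ˡ (m + (m + n))) ]′
  σ-eq : ∀ (e : (Fin n′ → ℕ) × (Fin m → ℕ) × (Fin m → ℕ) × (Fin n → ℕ)) x →
         (proj₁ (proj₂ e) ⊕ proj₁ e) x ≡ ν e (σ (splitAt m x))
  σ-eq e@(N′ , M′ , M , N) x with splitAt m x
  ... | inj₁ y = sym (trans (⊕-ʳ N′ (M′ ⊕ (M ⊕ N)) (y ↑ˡ (m + n))) (⊕-ˡ M′ (M ⊕ N) y))
  ... | inj₂ z = sym (⊕-ˡ N′ (M′ ⊕ (M ⊕ N)) z)

swapᵈ : ∀ {m n} {P : (Fin m → ℕ) → (Fin n → ℕ) → Set} →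
        Definable pair (uncurry P) → Definable pair (λ (N , M) → P M N)
swapᵈ {m} {n} = renameᵈ (λ (N , M) → M , N) (λ x → σ (splitAt m x)) σ-eq
  where
  σ : Fin m ⊎ Fin n → Fin (n + m)
  σ = [ n ↑ʳ_ , _↑ˡ m ]′
  σ-eq : ∀ (e : (Fin n → ℕ) × (Fin m → ℕ)) x → (proj₂ e ⊕ proj₁ e) x ≡ pair e (σ (splitAt m x))
  σ-eq (N , M) x with splitAt m x
  ... | inj₁ y = sym (⊕-ʳ N M y)
  ... | inj₂ z = sym (⊕-ˡ N M z)

reach-definable : ∀ {ℓ m n} K t (C : Mat ℓ m) (D : Mat ℓ n) → Definable pair (uncurry (Reach K t C D))
reach-definable K zero    C D = good-definable K C D
reach-definable K (suc t) C D =
  good-definable K C D ∨ᵈ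
  step-definable C D (reach-definable K t C (refine D)) ∨ᵈ
  swapᵈ (step-definable D C (reach-definable K t D (refine C)))

floor≤sumMat : ∀ {ℓ m} (C : Mat ℓ m) i j → ⌊ C i j ⌋𝔹 ≤ sumMat C
floor≤sumMat C i j = ≤-trans (term≤sum (λ j → ⌊ C i j ⌋𝔹) j) (term≤sum (λ i → sumFin (λ j → ⌊ C i j ⌋𝔹)) i)

theorem9 : ∀ {ℓ m n} (C : Mat ℓ m) (D : Mat ℓ n) →
    Σ (Formula (m + n)) λ φ →
    (M : Fin m → ℕ) (N : Fin n → ℕ) → BigEnough C D M N →
    (BiregExists C D M N ⇔ ⟦ φ ⟧ (M ⊕ N))
theorem9 {ℓ} C D = proj₁ formula , λ M N _ → proj₂ formula (M , N) ⇔-∘ mk⇔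
  (reached ∘ graph⇒realisation)
  (realisation⇒graph ∘ reach⇒realisation B K t C D
    (λ i j → ≤-trans (floor≤sumMat C i j) (m≤m+n (sumMat C) (sumMat D)))
    (λ i k → ≤-trans (floor≤sumMat D i k) (m≤n+m (sumMat D) (sumMat C))) ≤-refl)
  where
  -- Any common bound on the floors of both matrices would serve.
  B = sumMat C + sumMat D
  K = threshold ℓ B
  -- Each side has two truncated loads per colour, each at most `K`: a bound on the number of
  -- removals that does not depend on `M` and `N`.
  t = ℓ * (2 * K) + ℓ * (2 * K)
  formula = reach-definable K t C D
  reached : ∀ {M N} → Realisation C D M N → Reach K t C D M N
  reached r = realisation⇒reach K t r
    (+-mono-≤ (potential-bound K C (Realisation.f r)) (potential-bound K D (Realisation.g r)))
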